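{- Let $p$ be a prime number and let $A\subset\mathbb{F}_p$ be a set such that $A\cap(-A)=\emptyset$, where $-A=\{ -a\mid a\in A\}$. For every integer $\alpha\in[0,|A|]$, \[|\Sigma_\alpha(A)|=|\Sigma^\alpha(A)|\geqslant\min\left\{p,\ \frac{|A|(|A|+1)}{2}-\frac{\alpha(\alpha+1)}{2}+1\right\}.\]
   Context: For $A\subset\mathbb{F}_p$ and an integer $k\in[0,|A|]$, let $k^\wedge A=\{a_1+\dots+a_k\mid a_i\in A,\ a_i\neq a_j \text{ for } i\neq j\}$ denote the set of sums of $k$ pairwise distinct elements of $A$ (with $0^\wedge A=\{0\}$). Define $\Sigma_\alpha(A)=\bigcup_{k=\alpha}^{|A|}(k^\wedge A)$, the set of subsums of at least $\alpha$ pairwise distinct elements of $A$, and $\Sigma^\alpha(A)=\bigcup_{k=0}^{|A|-\alpha}(k^\wedge A)$, the set of subsums of at most $|A|-\alpha$ pairwise distinct elements of $A$. -}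

module Defs where

open import Data.Nat using (ℕ; _≤_; _∸_; NonZero)
open import Data.Nat.Properties using (_≤?_)
open import Data.Nat.DivMod using (_mod_)
open import Data.Fin using (Fin; toℕ)
open import Data.Fin.Properties using (_≟_)
open import Data.Fin.Subset using (Subset; _∈_; _⊆_; ∣_∣)
open import Data.Fin.Subset.Properties using (_∈?_; _⊆?_; anySubset?)
open import Data.List using (List; map; filter; allFin)
open import Data.Nat.ListAction using (sum)
open import Data.Vec using (tabulate)
open import Data.Product using (∃; _×_)
open import Relation.Nullary using (¬_; Dec; does)
open import Relation.Nullary.Decidable using (_×-dec_)
open import Relation.Binary.PropositionalEquality using (_≡_)

-- Elements of F_p are represented by Fin p (residues 0..p-1); subsets of F_p by Subset p.

negF : ∀ {p} .{{_ : NonZero p}} → Fin p → Fin p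
negF {p} x = (p ∸ toℕ x) mod p

Disjoint-neg : ∀ {p} .{{_ : NonZero p}} → Subset p → Set
Disjoint-neg {p} A = ∀ (x : Fin p) → x ∈ A → ¬ (negF x ∈ A)

natSum : ∀ {n} → Subset n → ℕ
natSum {n} B = sum (map toℕ (filter (λ i → i ∈? B) (allFin n)))

sumF : ∀ {p} .{{_ : NonZero p}} → Subset p → Fin p
sumF {p} B = natSum B mod p

InSigmaLow : ∀ {p} .{{_ : NonZero p}} → Subset p → ℕ → Fin p → Set
InSigmaLow A α x = ∃ λ B → B ⊆ A × α ≤ ∣ B ∣ × sumF B ≡ x

InSigmaHigh : ∀ {p} .{{_ : NonZero p}} → Subset p → ℕ → Fin p → Set
InSigmaHigh A α x = ∃ λ B → B ⊆ A × ∣ B ∣ ≤ ∣ A ∣ ∸ α × sumF B ≡ x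

inSigmaLow? : ∀ {p} .{{_ : NonZero p}} (A : Subset p) (α : ℕ) (x : Fin p) → Dec (InSigmaLow A α x)
inSigmaLow? A α x = anySubset? (λ B → (B ⊆? A) ×-dec ((α ≤? ∣ B ∣) ×-dec (sumF B ≟ x)))

inSigmaHigh? : ∀ {p} .{{_ : NonZero p}} (A : Subset p) (α : ℕ) (x : Fin p) → Dec (InSigmaHigh A α x)
inSigmaHigh? A α x = anySubset? (λ B → (B ⊆? A) ×-dec ((∣ B ∣ ≤? ∣ A ∣ ∸ α) ×-dec (sumF B ≟ x)))

SigmaLow : ∀ {p} .{{_ : NonZero p}} → Subset p → ℕ → Subset p
SigmaLow A α = tabulate (λ x → does (inSigmaLow? A α x))

SigmaHigh : ∀ {p} .{{_ : NonZero p}} → Subset p → ℕ → Subset p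
SigmaHigh A α = tabulate (λ x → does (inSigmaHigh? A α x))

{-# OPTIONS --safe #-}
module Submission where

-- Let d = |A|.  Doubling subset sums of A and subtracting the sum of A turns them into the signed sums
-- ±a₁ ± … ± a_d, and "at most d - α summands" into "at most d - α plus signs".  Choose a set I of at
-- most d - α elements of {1, …, d} with sum s, where s is the number of sums obtained; this is possible
-- as soon as s is below the claimed bound.  For coordinates x₁, …, x_d let
--   V = ∏_{i<j} (x_i - x_j) · ∏_{i<j, j ∈ I} (x_i + x_j),
-- and let x_i range over {-a_d, …, -a₁, a₁, …, a_i} if i ∈ I and over {-a_d, …, -a_i} otherwise.  Points
-- of this box with V ≠ 0 are signed permutations of A with at most |I| plus signs, so V · ∏_c (Σ x - c),
-- with c running over the s signed sums, vanishes on the box.  Its degree is exactly the sum of the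
-- (box size - 1), so the coefficient extracted by iterated divided differences depends only on the
-- leading forms and the box sizes (the coefficient formula of the Combinatorial Nullstellensatz).
-- Evaluating the same coefficient with a_i = i, where the signed sums form an arithmetic progression,
-- and with the s values below the largest one as the c, leaves a single nonzero term, at the top corner
-- of the box; it is nonzero modulo p because s < p.  This is the contradiction.

open import Defs
open import Algebra.Bundles using (CommutativeRing)
open import Data.Bool using (Bool; true; false; if_then_else_)
open import Data.Fin using (Fin; zero; suc; toℕ)
import Data.Fin.Properties as Fin
open import Data.List as List using (List; []; _∷_; _++_; length; filter; foldr; allFin; tabulate; upTo)
import Data.List.Properties as List
open import Data.List.Membership.Propositional using (_∈_; _∉_; find)
open import Data.List.Relation.Unary.All as All using (All; []; _∷_)
open import Data.List.Relation.Unary.AllPairs as AllPairs using (AllPairs; []; _∷_)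
open import Data.List.Relation.Unary.Any using (here; there)
open import Data.Nat as ℕ using (ℕ; zero; suc; z≤n; s≤s; NonZero; _⊓_)
import Data.Nat.Properties as ℕ
open import Data.Product using (∃; _×_; _,_; proj₁; proj₂; map₂)
open import Data.Sum using (_⊎_; inj₁; inj₂)
open import Data.Vec as Vec using (Vec; []; _∷_; lookup; updateAt; toList; fromList)
open import Data.Vec.Relation.Binary.Pointwise.Inductive using (Pointwise; []; _∷_)
open import Data.Vec.Relation.Unary.All as VAll using ([]; _∷_)
open import Function using (_∘_; id)
open import Level using (0ℓ; _⊔_)
open import Relation.Nullary using (¬_; Dec; does; yes; no; contradiction)
open import Relation.Binary.PropositionalEquality as ≡ using (_≡_; _≢_)

-- Sizes of boxes, given as vectors of lists.

tail : ∀ {a} {A : Set a} → List A → List A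
tail = List.drop 1

totalLength : ∀ {a n} {A : Set a} → Vec (List A) n → ℕ
totalLength = Vec.foldr′ (λ B l → length B ℕ.+ l) 0

-- Removing a node costs at most one, and nothing from an empty list; the degree inductions pay one
-- factor for each removed node.
totalLength-tail : ∀ {a n} {A : Set a} (Bs : Vec (List A) n) i →
  totalLength Bs ℕ.≤ suc (totalLength (updateAt Bs i tail))
totalLength-tail ([]      ∷ Bs) zero    = ℕ.n≤1+n _
totalLength-tail ((_ ∷ _) ∷ Bs) zero    = ℕ.≤-refl
totalLength-tail (B       ∷ Bs) (suc i) = ℕ.≤-trans
  (ℕ.+-monoʳ-≤ (length B) (totalLength-tail Bs i))
  (ℕ.≤-reflexive (ℕ.+-suc (length B) _))

SameLengths : ∀ {a n} {A : Set a} → Vec (List A) n → Vec (List A) n → Set a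
SameLengths = Pointwise (λ B B′ → length B ≡ length B′)

sameLengths-tail : ∀ {a n} {A : Set a} {Bs Bs′ : Vec (List A) n} i →
  SameLengths Bs Bs′ → SameLengths (updateAt Bs i tail) (updateAt Bs′ i tail)
sameLengths-tail {Bs = B ∷ _} {B′ ∷ _} zero (eq ∷ eqs) =
  ≡.trans (List.length-drop 1 B) (≡.trans (≡.cong (ℕ._∸ 1) eq) (≡.sym (List.length-drop 1 B′))) ∷ eqs
sameLengths-tail (suc i) (eq ∷ eqs) = eq ∷ sameLengths-tail i eqs

-- Divided differences in one variable over a field.

InvertsNonzero : ∀ {c ℓ} (R : CommutativeRing c ℓ) →
  (CommutativeRing.Carrier R → CommutativeRing.Carrier R) → Set (c ⊔ ℓ)
InvertsNonzero R inv = ∀ x → ¬ x ≈ 0# → x * inv x ≈ 1#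
  where open CommutativeRing R

module DividedDifferences {c ℓ} (R : CommutativeRing c ℓ)
  (inv : CommutativeRing.Carrier R → CommutativeRing.Carrier R)
  (*-inv : InvertsNonzero R inv) where

  open CommutativeRing R
  open import Algebra.Properties.CommutativeSemigroup +-commutativeSemigroup using (interchange)
  open import Algebra.Properties.Ring ring using (-‿distribˡ-*; -‿distribʳ-*; -‿+-comm)
  open import Relation.Binary.Reasoning.Setoid setoid

  +-interchange-neg : ∀ u v u′ v′ → u + v - (u′ + v′) ≈ (u - u′) + (v - v′)
  +-interchange-neg u v u′ v′ = trans (+-congˡ (sym (-‿+-comm u′ v′))) (interchange u v (- u′) (- v′))

  -- The inductive step of the Leibniz rule in bare algebra: `u` and `v` stand for the divided
  -- differences starting with `b` and `b′`, `w` for the one on the remaining nodes, and `i` for the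
  -- inverse of `b - b′`.
  leibniz-identity : ∀ b b′ u v w i →
    (w + b * u - (w + b′ * v)) * i ≈ (b - b′) * i * v + b * ((u - v) * i)
  leibniz-identity b b′ u v w i = begin
    (w + b * u - (w + b′ * v)) * i
      ≈⟨ *-congʳ (trans (+-interchange-neg w (b * u) w (b′ * v)) (trans (+-congʳ (-‿inverseʳ w)) (+-identityˡ _))) ⟩
    (b * u - b′ * v) * i
      ≈⟨ *-congʳ (+-cong (sym (telescope (b * u) (b * v))) (-‿distribˡ-* b′ v)) ⟩
    ((b * u - b * v + b * v) + - b′ * v) * i
      ≈⟨ *-congʳ (trans (+-assoc _ _ _) (+-cong (trans (+-congˡ (-‿distribʳ-* b v)) (sym (distribˡ b u (- v)))) (sym (distribʳ v b (- b′))))) ⟩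
    (b * (u - v) + (b - b′) * v) * i
      ≈⟨ distribʳ i _ _ ⟩
    b * (u - v) * i + (b - b′) * v * i
      ≈⟨ +-cong (*-assoc b _ i) (trans (*-assoc _ v i) (trans (*-congˡ (*-comm v i)) (sym (*-assoc _ i v)))) ⟩
    b * ((u - v) * i) + (b - b′) * i * v
      ≈⟨ +-comm _ _ ⟩
    (b - b′) * i * v + b * ((u - v) * i) ∎
    where
    telescope : ∀ x y → x - y + y ≈ x
    telescope x y = trans (+-assoc x (- y) y) (trans (+-congˡ (-‿inverseˡ y)) (+-identityʳ x))

  nonzero-* : ∀ {x y} → ¬ x ≈ 0# → ¬ y ≈ 0# → ¬ x * y ≈ 0#
  nonzero-* {x} {y} x≉0 y≉0 xy≈0 = y≉0 (begin
    y               ≈⟨ *-identityˡ y ⟨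
    1# * y          ≈⟨ *-congʳ (*-inv x x≉0) ⟨
    x * inv x * y   ≈⟨ trans (*-congʳ (*-comm x (inv x))) (*-assoc (inv x) x y) ⟩
    inv x * (x * y) ≈⟨ *-congˡ xy≈0 ⟩
    inv x * 0#      ≈⟨ zeroʳ _ ⟩
    0#              ∎)

  nonzero-inv : ∀ {x} → ¬ x ≈ 0# → ¬ inv x ≈ 0#
  nonzero-inv {x} x≉0 i≈0 = x≉0 (begin
    x               ≈⟨ *-identityʳ x ⟨
    x * 1#          ≈⟨ *-congˡ (*-inv x x≉0) ⟨
    x * (x * inv x) ≈⟨ *-congˡ (*-congˡ i≈0) ⟩
    x * (x * 0#)    ≈⟨ *-congˡ (zeroʳ x) ⟩
    x * 0#          ≈⟨ zeroʳ x ⟩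
    0#              ∎)

  Distinct : List Carrier → Set (c ⊔ ℓ)
  Distinct = AllPairs (λ x y → ¬ x - y ≈ 0#)

  -- Newton's divided difference on the nodes `b ∷ B`. By symmetry in the nodes, the recursion may
  -- drop one of the first two instead of the first or the last, which makes it structural.
  divDiff₁ : Carrier → List Carrier → (Carrier → Carrier) → Carrier
  divDiff₁ b []       f = f b
  divDiff₁ b (b′ ∷ B) f = (divDiff₁ b B f - divDiff₁ b′ B f) * inv (b - b′)

  -- The value 0 on the empty list makes the Leibniz rule hold without side conditions.
  divDiff : List Carrier → (Carrier → Carrier) → Carrier
  divDiff []      f = 0#
  divDiff (b ∷ B) f = divDiff₁ b B f

  divDiff₁-cong : ∀ b B {f g} → (∀ x → x ∈ b ∷ B → f x ≈ g x) → divDiff₁ b B f ≈ divDiff₁ b B g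
  divDiff₁-cong b []       eq = eq b (here ≡.refl)
  divDiff₁-cong b (b′ ∷ B) eq = *-congʳ (+-cong
    (divDiff₁-cong b B λ { x (here e) → eq x (here e) ; x (there m) → eq x (there (there m)) })
    (-‿cong (divDiff₁-cong b′ B λ x m → eq x (there m))))

  divDiff-cong : ∀ B {f g} → (∀ x → x ∈ B → f x ≈ g x) → divDiff B f ≈ divDiff B g
  divDiff-cong []      eq = refl
  divDiff-cong (b ∷ B) eq = divDiff₁-cong b B eq

  divDiff₁-+ : ∀ b B f g → divDiff₁ b B (λ x → f x + g x) ≈ divDiff₁ b B f + divDiff₁ b B g
  divDiff₁-+ b []       f g = refl
  divDiff₁-+ b (b′ ∷ B) f g = trans
    (*-congʳ (+-cong (divDiff₁-+ b B f g) (-‿cong (divDiff₁-+ b′ B f g))))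
    (trans (*-congʳ (+-interchange-neg _ _ _ _)) (distribʳ _ _ _))

  divDiff-+ : ∀ B f g → divDiff B (λ x → f x + g x) ≈ divDiff B f + divDiff B g
  divDiff-+ []      f g = sym (+-identityʳ 0#)
  divDiff-+ (b ∷ B) f g = divDiff₁-+ b B f g

  divDiff₁-* : ∀ b B k f → divDiff₁ b B (λ x → k * f x) ≈ k * divDiff₁ b B f
  divDiff₁-* b []       k f = refl
  divDiff₁-* b (b′ ∷ B) k f = trans
    (*-congʳ (+-cong (divDiff₁-* b B k f) (-‿cong (divDiff₁-* b′ B k f))))
    (trans (*-congʳ (trans (+-congˡ (-‿distribʳ-* k _)) (sym (distribˡ k _ _)))) (*-assoc k _ _))

  divDiff-* : ∀ B k f → divDiff B (λ x → k * f x) ≈ k * divDiff B f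
  divDiff-* []      k f = sym (zeroʳ k)
  divDiff-* (b ∷ B) k f = divDiff₁-* b B k f

  divDiff-zero : ∀ B {f} → (∀ x → x ∈ B → f x ≈ 0#) → divDiff B f ≈ 0#
  divDiff-zero B {f} f≈0 = begin
    divDiff B f                ≈⟨ divDiff-cong B (λ x x∈B → trans (f≈0 x x∈B) (sym (zeroˡ 0#))) ⟩
    divDiff B (λ _ → 0# * 0#)  ≈⟨ divDiff-* B 0# (λ _ → 0#) ⟩
    0# * _                     ≈⟨ zeroˡ _ ⟩
    0#                         ∎

  -- The default is harmless: in the Leibniz rule it multiplies `divDiff [] f`, which is 0.
  headOr0 : List Carrier → Carrier
  headOr0 []      = 0#
  headOr0 (b ∷ _) = b

  -- In the inductive step both shorter divided differences contain the term `divDiff B f`, which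
  -- cancels.
  divDiff₁-leibniz : ∀ b B f → Distinct (b ∷ B) →
    divDiff₁ b B (λ x → x * f x) ≈ divDiff B f + b * divDiff₁ b B f
  divDiff₁-leibniz b []       f _ = sym (+-identityˡ _)
  divDiff₁-leibniz b (b′ ∷ B) f ((b≉b′ ∷ b≉) ∷ b′≉ ∷ ds) = begin
    (divDiff₁ b B _ - divDiff₁ b′ B _) * i
      ≈⟨ *-congʳ (+-cong (divDiff₁-leibniz b B f (b≉ ∷ ds))
                         (-‿cong (divDiff₁-leibniz b′ B f (b′≉ ∷ ds)))) ⟩
    (w + b * u - (w + b′ * v)) * i
      ≈⟨ leibniz-identity b b′ u v w i ⟩
    (b - b′) * i * v + b * ((u - v) * i)
      ≈⟨ +-congʳ (trans (*-congʳ (*-inv _ b≉b′)) (*-identityˡ v)) ⟩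
    v + b * ((u - v) * i) ∎
    where
    i = inv (b - b′)
    u = divDiff₁ b B f
    v = divDiff₁ b′ B f
    w = divDiff B f

  divDiff-leibniz : ∀ B f → Distinct B →
    divDiff B (λ x → x * f x) ≈ divDiff (tail B) f + headOr0 B * divDiff B f
  divDiff-leibniz []      f _  = sym (trans (+-identityˡ _) (zeroˡ _))
  divDiff-leibniz (b ∷ B) f ds = divDiff₁-leibniz b B f ds

  -- With two or more nodes both sides are 0, since induction identifies the two terms being
  -- subtracted; with a single node both are `k`.
  divDiff₁-const-sameLength : ∀ b B b′ B′ k → length B ≡ length B′ →
    divDiff₁ b B (λ _ → k) ≈ divDiff₁ b′ B′ (λ _ → k)
  divDiff₁-const-sameLength b []      b′ []        k eq = refl
  divDiff₁-const-sameLength b (x ∷ B) b′ (x′ ∷ B′) k eq = trans (zero-diff b x B _) (sym (zero-diff b′ x′ B′ _))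
    where
    zero-diff : ∀ b x B i → (divDiff₁ b B (λ _ → k) - divDiff₁ x B (λ _ → k)) * i ≈ 0#
    zero-diff b x B i = trans
      (*-congʳ (trans (+-congʳ (divDiff₁-const-sameLength b B x B k ≡.refl)) (-‿inverseʳ _)))
      (zeroˡ i)

  divDiff-const-sameLength : ∀ B B′ k → length B ≡ length B′ →
    divDiff B (λ _ → k) ≈ divDiff B′ (λ _ → k)
  divDiff-const-sameLength []      []        k eq = refl
  divDiff-const-sameLength (b ∷ B) (b′ ∷ B′) k eq =
    divDiff₁-const-sameLength b B b′ B′ k (ℕ.suc-injective eq)

  divDiff-const-zero : ∀ b b′ B k → divDiff (b ∷ b′ ∷ B) (λ _ → k) ≈ 0#
  divDiff-const-zero b b′ B k = trans
    (*-congʳ (trans (+-congʳ (divDiff₁-const-sameLength b B b′ B k ≡.refl)) (-‿inverseʳ _)))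
    (zeroˡ _)

  -- Only `b` contributes, so the value is `f b` divided by the product of the differences `b - x`
  -- for x in `B`.
  divDiff₁-nonzero : ∀ b B f → Distinct (b ∷ B) →
    ¬ f b ≈ 0# → (∀ x → x ∈ B → f x ≈ 0#) → ¬ divDiff₁ b B f ≈ 0#
  divDiff₁-nonzero b []       f _ fb≉0 f≈0 = fb≉0
  divDiff₁-nonzero b (b′ ∷ B) f ((b≉b′ ∷ b≉) ∷ _ ∷ ds) fb≉0 f≈0 =
    nonzero-* (λ diff≈0 → divDiff₁-nonzero b B f (b≉ ∷ ds) fb≉0 (λ x x∈B → f≈0 x (there x∈B)) (begin
      u       ≈⟨ sym (trans (+-assoc u (- v) v) (trans (+-congˡ (-‿inverseˡ v)) (+-identityʳ u))) ⟩
      u - v + v ≈⟨ +-cong diff≈0 (divDiff-zero (b′ ∷ B) f≈0) ⟩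
      0# + 0#   ≈⟨ +-identityˡ 0# ⟩
      0#        ∎))
      (nonzero-inv b≉b′)
    where
    u = divDiff₁ b B f
    v = divDiff₁ b′ B f

  -- Iterated divided differences on boxes.

  -- For nonempty lists of distinct nodes and a polynomial of degree at most the sum of all (list
  -- length - 1), this is the coefficient of the monomial whose i-th exponent is the length of the
  -- i-th list minus 1.
  functional : ∀ {n} → Vec (List Carrier) n → (Vec Carrier n → Carrier) → Carrier
  functional []       f = f []
  functional (B ∷ Bs) f = divDiff B λ x → functional Bs λ xs → f (x ∷ xs)

  functional-cong : ∀ {n} (Bs : Vec (List Carrier) n) {f g} →
    (∀ xs → Pointwise _∈_ xs Bs → f xs ≈ g xs) → functional Bs f ≈ functional Bs g
  functional-cong []       eq = eq [] []
  functional-cong (B ∷ Bs) eq = divDiff-cong B λ x x∈B →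
    functional-cong Bs λ xs xs∈Bs → eq (x ∷ xs) (x∈B ∷ xs∈Bs)

  functional-+ : ∀ {n} (Bs : Vec (List Carrier) n) f g →
    functional Bs (λ xs → f xs + g xs) ≈ functional Bs f + functional Bs g
  functional-+ []       f g = refl
  functional-+ (B ∷ Bs) f g = trans
    (divDiff-cong B λ x _ → functional-+ Bs (λ xs → f (x ∷ xs)) (λ xs → g (x ∷ xs)))
    (divDiff-+ B _ _)

  functional-* : ∀ {n} (Bs : Vec (List Carrier) n) k f →
    functional Bs (λ xs → k * f xs) ≈ k * functional Bs f
  functional-* []       k f = refl
  functional-* (B ∷ Bs) k f = trans
    (divDiff-cong B λ x _ → functional-* Bs k (λ xs → f (x ∷ xs)))
    (divDiff-* B k _)

  functional-zero : ∀ {n} (Bs : Vec (List Carrier) n) {f} →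
    (∀ xs → Pointwise _∈_ xs Bs → f xs ≈ 0#) → functional Bs f ≈ 0#
  functional-zero []       f≈0 = f≈0 [] []
  functional-zero (B ∷ Bs) f≈0 = divDiff-zero B λ x x∈B →
    functional-zero Bs λ xs xs∈Bs → f≈0 (x ∷ xs) (x∈B ∷ xs∈Bs)

  functional-leibniz : ∀ {n} (Bs : Vec (List Carrier) n) i f → VAll.All Distinct Bs →
    functional Bs (λ xs → lookup xs i * f xs) ≈
    functional (updateAt Bs i tail) f + headOr0 (lookup Bs i) * functional Bs f
  functional-leibniz (B ∷ Bs) zero f (d ∷ _) = trans
    (divDiff-cong B λ x _ → functional-* Bs x (λ xs → f (x ∷ xs)))
    (divDiff-leibniz B (λ x → functional Bs λ xs → f (x ∷ xs)) d)
  functional-leibniz (B ∷ Bs) (suc i) f (_ ∷ ds) = trans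
    (divDiff-cong B λ x _ → functional-leibniz Bs i (λ xs → f (x ∷ xs)) ds)
    (trans (divDiff-+ B _ _) (+-congˡ (divDiff-* B _ _)))

  -- In each coordinate only the first node contributes, so what remains is `f tops` divided by
  -- nonzero differences of nodes.
  functional-nonzero : ∀ {n} (tops : Vec Carrier n) (rests : Vec (List Carrier) n) f →
    VAll.All Distinct (Vec.zipWith _∷_ tops rests) →
    (∀ xs → Pointwise _∈_ xs (Vec.zipWith _∷_ tops rests) → xs ≢ tops → f xs ≈ 0#) →
    ¬ f tops ≈ 0# → ¬ functional (Vec.zipWith _∷_ tops rests) f ≈ 0#
  functional-nonzero []           []             f _                   f≈0 ftops≉0 = ftops≉0
  functional-nonzero (top ∷ tops) (rest ∷ rests) f ((top≉ ∷ d) ∷ ds) f≈0 ftops≉0 =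
    divDiff₁-nonzero top rest _ (top≉ ∷ d)
      (functional-nonzero tops rests (λ xs → f (top ∷ xs)) ds
        (λ xs xs∈ xs≢ → f≈0 (top ∷ xs) (here ≡.refl ∷ xs∈) (λ { ≡.refl → xs≢ ≡.refl }))
        ftops≉0)
      (λ x x∈rest → functional-zero (Vec.zipWith _∷_ tops rests) λ xs xs∈ →
        f≈0 (x ∷ xs) (there x∈rest ∷ xs∈)
          (λ { ≡.refl → All.lookup top≉ x∈rest (-‿inverseʳ x) }))

  -- Coefficients of products of affine forms.

  -- The constant of an affine form is kept apart from its linear terms, so that two products can
  -- share their leading forms and differ in the constants.
  LinForm : ℕ → Set c
  LinForm n = List (Carrier × Fin n)

  evalAffine : ∀ {n} → LinForm n → Carrier → Vec Carrier n → Carrier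
  evalAffine []            k xs = k
  evalAffine ((t , i) ∷ φ) k xs = t * lookup xs i + evalAffine φ k xs

  product : ∀ {n} → List (LinForm n × Carrier) → Vec Carrier n → Carrier
  product []            xs = 1#
  product ((φ , k) ∷ F) xs = evalAffine φ k xs * product F xs

  distinct-tail : ∀ {n} (Bs : Vec (List Carrier) n) i →
    VAll.All Distinct Bs → VAll.All Distinct (updateAt Bs i tail)
  distinct-tail ([]      ∷ _)  zero    (d ∷ ds)       = [] ∷ ds
  distinct-tail ((_ ∷ _) ∷ _)  zero    ((_ ∷ d) ∷ ds) = d ∷ ds
  distinct-tail (_       ∷ Bs) (suc i) (d ∷ ds)       = d ∷ distinct-tail Bs i ds

  -- In the Leibniz rule the term with the first node is a multiple of `functional Bs g`, which is
  -- 0; so a summand `t * xᵢ` just removes a node from the i-th list.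
  functional-affine-cons : ∀ {n} (Bs : Vec (List Carrier) n) → VAll.All Distinct Bs →
    ∀ t i φ k g → functional Bs g ≈ 0# →
    functional Bs (λ xs → evalAffine ((t , i) ∷ φ) k xs * g xs) ≈
    t * functional (updateAt Bs i tail) g + functional Bs (λ xs → evalAffine φ k xs * g xs)
  functional-affine-cons Bs ds t i φ k g g≈0 = begin
    functional Bs (λ xs → (t * lookup xs i + evalAffine φ k xs) * g xs)
      ≈⟨ functional-cong Bs (λ xs _ → trans (distribʳ _ _ _) (+-congʳ (*-assoc _ _ _))) ⟩
    functional Bs (λ xs → t * (lookup xs i * g xs) + evalAffine φ k xs * g xs)
      ≈⟨ functional-+ Bs _ _ ⟩
    functional Bs (λ xs → t * (lookup xs i * g xs)) + r
      ≈⟨ +-congʳ (functional-* Bs t _) ⟩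
    t * functional Bs (λ xs → lookup xs i * g xs) + r
      ≈⟨ +-congʳ (*-congˡ (functional-leibniz Bs i g ds)) ⟩
    t * (functional (updateAt Bs i tail) g + headOr0 (lookup Bs i) * functional Bs g) + r
      ≈⟨ +-congʳ (*-congˡ (trans (+-congˡ (trans (*-congˡ g≈0) (zeroʳ _))) (+-identityʳ _))) ⟩
    t * functional (updateAt Bs i tail) g + r ∎
    where
    r = functional Bs (λ xs → evalAffine φ k xs * g xs)

  -- More than `n` nodes in `n` lists put at least two into some list, and constants have divided
  -- difference 0 there.
  functional-const-zero : ∀ {n} (Bs : Vec (List Carrier) n) k → n ℕ.< totalLength Bs →
    functional Bs (λ _ → k) ≈ 0#
  functional-const-zero ([]          ∷ Bs) k lt = refl
  functional-const-zero ((b ∷ [])    ∷ Bs) k (s≤s lt) = functional-const-zero Bs k lt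
  functional-const-zero ((b ∷ b′ ∷ B) ∷ Bs) k lt = divDiff-const-zero b b′ B _

  -- The degree is below the sum of (list length - 1). Every factor uses up at most one node, so
  -- more than `n` nodes are left when the factors are exhausted.
  functional-lowDegree : ∀ {n} (F : List (LinForm n × Carrier)) (Bs : Vec (List Carrier) n) →
    VAll.All Distinct Bs → length F ℕ.+ n ℕ.< totalLength Bs → functional Bs (product F) ≈ 0#
  functional-lowDegree [] Bs ds lt = functional-const-zero Bs 1# lt
  functional-lowDegree ((φ , k) ∷ F) Bs ds lt = go φ
    where
    F≈0 : functional Bs (product F) ≈ 0#
    F≈0 = functional-lowDegree F Bs ds (ℕ.<-trans (ℕ.n<1+n _) lt)
    go : ∀ φ → functional Bs (λ xs → evalAffine φ k xs * product F xs) ≈ 0#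
    go []            = trans (functional-* Bs k _) (trans (*-congˡ F≈0) (zeroʳ k))
    go ((t , i) ∷ φ) = begin
      functional Bs (λ xs → evalAffine ((t , i) ∷ φ) k xs * product F xs)
        ≈⟨ functional-affine-cons Bs ds t i φ k _ F≈0 ⟩
      t * functional (updateAt Bs i tail) (product F) + functional Bs (λ xs → evalAffine φ k xs * product F xs)
        ≈⟨ +-cong (*-congˡ (functional-lowDegree F (updateAt Bs i tail) (distinct-tail Bs i ds)
                     (ℕ.s≤s⁻¹ (ℕ.<-≤-trans lt (totalLength-tail Bs i)))))
                  (go φ) ⟩
      t * 0# + 0# ≈⟨ trans (+-identityʳ _) (zeroʳ t) ⟩
      0# ∎

  functional-const-sameLengths : ∀ {n} (Bs Bs′ : Vec (List Carrier) n) → SameLengths Bs Bs′ → ∀ k →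
    functional Bs (λ _ → k) ≈ functional Bs′ (λ _ → k)
  functional-const-sameLengths []       []         _          k = refl
  functional-const-sameLengths (B ∷ Bs) (B′ ∷ Bs′) (eq ∷ eqs) k = trans
    (divDiff-cong B λ _ _ → functional-const-sameLengths Bs Bs′ eqs k)
    (divDiff-const-sameLength B B′ _ eq)

  -- Both sides equal the coefficient of ∏ᵢ xᵢ^(length Bᵢ ∸ 1), which is read off the leading forms alone.
  functional-topDegree : ∀ {n} (F F′ : List (LinForm n × Carrier)) (Bs Bs′ : Vec (List Carrier) n) →
    List.map proj₁ F ≡ List.map proj₁ F′ → SameLengths Bs Bs′ →
    VAll.All Distinct Bs → VAll.All Distinct Bs′ →
    length F ℕ.+ n ℕ.≤ totalLength Bs → length F′ ℕ.+ n ℕ.≤ totalLength Bs′ →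
    functional Bs (product F) ≈ functional Bs′ (product F′)
  functional-topDegree [] [] Bs Bs′ _ lens _ _ _ _ = functional-const-sameLengths Bs Bs′ lens 1#
  functional-topDegree ((φ , k) ∷ F) ((φ′ , k′) ∷ F′) Bs Bs′ eq lens ds ds′ le le′
    with ≡.refl , forms ← List.∷-injective eq = go φ
    where
    F≈0 : functional Bs (product F) ≈ 0#
    F≈0 = functional-lowDegree F Bs ds le
    F′≈0 : functional Bs′ (product F′) ≈ 0#
    F′≈0 = functional-lowDegree F′ Bs′ ds′ le′
    go : ∀ φ → functional Bs  (λ xs → evalAffine φ k  xs * product F  xs) ≈
               functional Bs′ (λ xs → evalAffine φ k′ xs * product F′ xs)
    -- Here the constants drop out: each multiplies a product with one factor less, whose degree is
    -- too low for the functional to see.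
    go [] = begin
      functional Bs (λ xs → k * product F xs)    ≈⟨ trans (functional-* Bs k _) (trans (*-congˡ F≈0) (zeroʳ k)) ⟩
      0#                                         ≈⟨ trans (functional-* Bs′ k′ _) (trans (*-congˡ F′≈0) (zeroʳ k′)) ⟨
      functional Bs′ (λ xs → k′ * product F′ xs) ∎
    go ((t , i) ∷ φ) = begin
      functional Bs (λ xs → evalAffine ((t , i) ∷ φ) k xs * product F xs)
        ≈⟨ functional-affine-cons Bs ds t i φ k _ F≈0 ⟩
      t * functional (updateAt Bs i tail) (product F) + functional Bs (λ xs → evalAffine φ k xs * product F xs)
        ≈⟨ +-cong (*-congˡ (functional-topDegree F F′ _ _ forms (sameLengths-tail i lens)
                     (distinct-tail Bs i ds) (distinct-tail Bs′ i ds′)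
                     (ℕ.s≤s⁻¹ (ℕ.≤-trans le (totalLength-tail Bs i)))
                     (ℕ.s≤s⁻¹ (ℕ.≤-trans le′ (totalLength-tail Bs′ i)))))
                  (go φ) ⟩
      t * functional (updateAt Bs′ i tail) (product F′) + functional Bs′ (λ xs → evalAffine φ k′ xs * product F′ xs)
        ≈⟨ functional-affine-cons Bs′ ds′ t i φ k′ _ F′≈0 ⟨
      functional Bs′ (λ xs → evalAffine ((t , i) ∷ φ) k′ xs * product F′ xs) ∎

open import Data.Fin.Subset using (Subset; ∣_∣) renaming (_∈_ to _∈ₛ_; _⊆_ to _⊆ₛ_)
open import Data.Fin.Subset.Properties using () renaming (_∈?_ to _∈ₛ?_)
open import Data.Integer using (ℤ; +_; 0ℤ; 1ℤ; -1ℤ; _+_; _*_; _-_; -_)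
import Data.Integer as ℤ
import Data.Integer.Properties as ℤ
open import Data.Integer.Divisibility.Signed using (divides; ∣m∣n⇒∣m+n; ∣m⇒∣-m; ∣m⇒∣m*n; ∣n⇒∣m*n; ∣ᵤ⇒∣; ∣⇒∣ᵤ) renaming (_∣_ to _∣ℤ_; _∣?_ to _∣ℤ?_)
open import Data.Integer.DivMod using (_%ℕ_; _/ℕ_; a≡a%ℕn+[a/ℕn]*n; n%ℕd<d)
open import Data.Integer.Tactic.RingSolver using (solve-∀)
open import Data.List.Membership.DecPropositional ℤ._≟_ using (_∈?_)
open import Data.List.Membership.Propositional.Properties using (∈-∃++; ∈-++⁻; ∈-++⁺ˡ; ∈-++⁺ʳ; ∈-map⁻; ∈-map⁺; ∈-filter⁻; ∈-filter⁺; ∈-allFin; ∈-upTo⁺; ∈-upTo⁻)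
open import Data.List.Relation.Binary.Permutation.Propositional using (_↭_; ↭-refl; ↭-sym; ↭-trans; prep; ↭⇒↭ₛ)
open import Data.List.Relation.Binary.Permutation.Propositional.Properties using (shift; ↭-length; All-resp-↭; ∈-resp-↭)
import Data.List.Relation.Binary.Permutation.Setoid.Properties as PermS
open import Data.List.Relation.Binary.Subset.Propositional using (_⊆_)
import Data.List.Relation.Unary.All.Properties as All
import Data.List.Relation.Unary.AllPairs.Properties as AllPairs
open import Data.List.Relation.Unary.Unique.Propositional using (Unique)
import Data.List.Relation.Unary.Unique.Propositional.Properties as Unique
open import Data.Nat.Coprimality using (prime⇒coprime; coprime-Bézout)
import Data.Nat.Divisibility as ℕ
import Data.Nat.DivMod as ℕ
open import Data.Nat.DivMod using (_mod_)
open import Data.Nat.GCD using (module Bézout)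
open import Data.Nat.ListAction using (sum)
open import Data.Nat.Primality using (Prime; prime⇒nonZero; prime⇒nonTrivial; euclidsLemma)
import Data.Nat.Tactic.RingSolver as ℕ-Solver
import Data.Vec.Properties as Vec
open import Relation.Binary.PropositionalEquality using (refl; sym; trans; cong; cong₂; subst; subst₂; setoid; module ≡-Reasoning)
open import Relation.Nullary.Decidable using (map′; ¬?; _×-dec_; dec-true; decidable-stable)
open import Relation.Unary using (Pred; Decidable)

-- The field of integers modulo p, as integers up to congruence.

module Modular (p : ℕ) where

  infix 4 _≈_

  record _≈_ (a b : ℤ) : Set where
    constructor congruent
    field p∣difference : (+ p) ∣ℤ (a - b)

  ≡⇒≈ : ∀ {a b} → a ≡ b → a ≈ b
  ≡⇒≈ {a} refl = congruent (divides 0ℤ (ℤ.+-inverseʳ a))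

  private
    by : ∀ {a b d} → a - b ≡ d → (+ p) ∣ℤ d → a ≈ b
    by refl h = congruent h

  infix 4 _≈?_

  _≈?_ : ∀ a b → Dec (a ≈ b)
  a ≈? b = map′ congruent _≈_.p∣difference ((+ p) ∣ℤ? (a - b))

  ≈-sym : ∀ {a b} → a ≈ b → b ≈ a
  ≈-sym {a} {b} (congruent h) = by (identity a b) (∣m⇒∣-m h)
    where
    identity : ∀ a b → b - a ≡ - (a - b)
    identity = solve-∀

  ≈-trans : ∀ {a b c} → a ≈ b → b ≈ c → a ≈ c
  ≈-trans {a} {b} {c} (congruent h) (congruent k) = by (identity a b c) (∣m∣n⇒∣m+n h k)
    where
    identity : ∀ a b c → a - c ≡ (a - b) + (b - c)
    identity = solve-∀

  +-cong-≈ : ∀ {a b c d} → a ≈ b → c ≈ d → a + c ≈ b + d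
  +-cong-≈ {a} {b} {c} {d} (congruent h) (congruent k) = by (identity a b c d) (∣m∣n⇒∣m+n h k)
    where
    identity : ∀ a b c d → a + c - (b + d) ≡ (a - b) + (c - d)
    identity = solve-∀

  *-cong-≈ : ∀ {a b c d} → a ≈ b → c ≈ d → a * c ≈ b * d
  *-cong-≈ {a} {b} {c} {d} (congruent h) (congruent k) = by (identity a b c d) (∣m∣n⇒∣m+n (∣m⇒∣m*n c h) (∣n⇒∣m*n b k))
    where
    identity : ∀ a b c d → a * c - b * d ≡ (a - b) * c + b * (c - d)
    identity = solve-∀

  -‿cong-≈ : ∀ {a b} → a ≈ b → - a ≈ - b
  -‿cong-≈ {a} {b} (congruent h) = by (identity a b) (∣m⇒∣-m h)
    where
    identity : ∀ a b → - a - - b ≡ - (a - b)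
    identity = solve-∀

  ℤ/p : CommutativeRing 0ℓ 0ℓ
  ℤ/p = record
    { Carrier = ℤ ; _≈_ = _≈_ ; _+_ = _+_ ; _*_ = _*_ ; -_ = -_ ; 0# = 0ℤ ; 1# = 1ℤ
    ; isCommutativeRing = record
      { isRing = record
        { +-isAbelianGroup = record
          { isGroup = record
            { isMonoid = record
              { isSemigroup = record
                { isMagma = record
                  { isEquivalence = record { refl = ≡⇒≈ refl ; sym = ≈-sym ; trans = ≈-trans }
                  ; ∙-cong = +-cong-≈ }
                ; assoc = λ a b c → ≡⇒≈ (ℤ.+-assoc a b c) }
              ; identity = (λ a → ≡⇒≈ (ℤ.+-identityˡ a)) , (λ a → ≡⇒≈ (ℤ.+-identityʳ a)) }
            ; inverse = (λ a → ≡⇒≈ (ℤ.+-inverseˡ a)) , (λ a → ≡⇒≈ (ℤ.+-inverseʳ a))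
            ; ⁻¹-cong = -‿cong-≈ }
          ; comm = λ a b → ≡⇒≈ (ℤ.+-comm a b) }
        ; *-cong = *-cong-≈
        ; *-assoc = λ a b c → ≡⇒≈ (ℤ.*-assoc a b c)
        ; *-identity = (λ a → ≡⇒≈ (ℤ.*-identityˡ a)) , (λ a → ≡⇒≈ (ℤ.*-identityʳ a))
        ; distrib = (λ a b c → ≡⇒≈ (ℤ.*-distribˡ-+ a b c)) , (λ a b c → ≡⇒≈ (ℤ.*-distribʳ-+ a b c)) }
      ; *-comm = λ a b → ≡⇒≈ (ℤ.*-comm a b) } }

  ≈0⇒∣ : ∀ {n} → + n ≈ 0ℤ → p ℕ.∣ n
  ≈0⇒∣ {n} (congruent h) = ∣⇒∣ᵤ (subst ((+ p) ∣ℤ_) (ℤ.+-identityʳ (+ n)) h)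

  ∣⇒≈0 : ∀ {n} → p ℕ.∣ n → + n ≈ 0ℤ
  ∣⇒≈0 {n} h = congruent (subst ((+ p) ∣ℤ_) (sym (ℤ.+-identityʳ (+ n))) (∣ᵤ⇒∣ h))

  0<n<p⇒≉0 : ∀ {n} → 0 ℕ.< n → n ℕ.< p → ¬ + n ≈ 0ℤ
  0<n<p⇒≉0 {suc n} _ n<p h = ℕ.>⇒∤ n<p (≈0⇒∣ h)

  -- The difference `n ∸ m` is a multiple of `p` below `p`, hence 0.
  ≈∧≤⇒≥ : ∀ {m n} → m ℕ.≤ n → n ℕ.< p → + n ≈ + m → n ℕ.≤ m
  ≈∧≤⇒≥ {m} {n} m≤n n<p (congruent h) = ℕ.m∸n≡0⇒m≤n (zero-or-large (n ℕ.∸ m) (ℕ.≤-<-trans (ℕ.m∸n≤m n m) n<p)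
    (∣⇒∣ᵤ (subst ((+ p) ∣ℤ_) (trans (ℤ.m-n≡m⊖n n m) (ℤ.⊖-≥ m≤n)) h)))
    where
    zero-or-large : ∀ k → k ℕ.< p → p ℕ.∣ k → k ≡ 0
    zero-or-large zero    _   _   = refl
    zero-or-large (suc k) k<p p∣k = contradiction p∣k (ℕ.>⇒∤ k<p)

  ≈-difference⇒≈ : ∀ {a b} → a - b ≈ 0ℤ → a ≈ b
  ≈-difference⇒≈ {a} {b} (congruent h) = congruent (subst ((+ p) ∣ℤ_) (ℤ.+-identityʳ (a - b)) h)

  <p⇒≡ : ∀ {m n} → m ℕ.< p → n ℕ.< p → + m ≈ + n → m ≡ n
  <p⇒≡ {m} {n} m<p n<p h with ℕ.≤-total m n
  ... | inj₁ m≤n = ℕ.≤-antisym m≤n (≈∧≤⇒≥ m≤n n<p (≈-sym h))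
  ... | inj₂ n≤m = ℕ.≤-antisym (≈∧≤⇒≥ n≤m m<p h) n≤m

  module Inverse (p-prime : Prime p) where

    private instance
      p-nonZero : NonZero p
      p-nonZero = prime⇒nonZero p-prime

    int-eq : ∀ a b c d → 1 ℕ.+ a ℕ.* b ≡ c ℕ.* d → 1ℤ + + a * + b ≡ + c * + d
    int-eq a b c d eq = trans (cong (λ z → 1ℤ + z) (sym (ℤ.pos-* a b)))
      (trans (sym (ℤ.pos-+ 1 (a ℕ.* b))) (trans (cong +_ eq) (ℤ.pos-* c d)))

    bézout-step : ∀ n y x p → 1ℤ + y * n ≡ x * p → n * - y - 1ℤ ≡ - x * p
    bézout-step n y x p eq = trans (left n y) (trans (cong -_ eq) (ℤ.neg-distribˡ-* x p))
      where
      left : ∀ n y → n * - y - 1ℤ ≡ - (1ℤ + y * n)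
      left = solve-∀

    bézout-step′ : ∀ n y x p → 1ℤ + x * p ≡ y * n → n * y - 1ℤ ≡ x * p
    bézout-step′ n y x p eq = trans (cong (_- 1ℤ) (trans (ℤ.*-comm n y) (sym eq))) (cancel (x * p))
      where
      cancel : ∀ z → 1ℤ + z - 1ℤ ≡ z
      cancel = solve-∀

    -- The witness is the Bézout coefficient of `n` against `p`; the two cases differ in its sign.
    inverse-nat : ∀ n → n ℕ.< p → ¬ + n ≈ 0ℤ → ∃ λ w → + n * w ≈ 1ℤ
    inverse-nat zero n<p n≉0 = contradiction (≡⇒≈ refl) n≉0
    inverse-nat n@(suc _) n<p n≉0 with coprime-Bézout (prime⇒coprime p-prime n<p)
    ... | Bézout.+- x y eq = - (+ y) , congruent (divides (- (+ x)) (bézout-step (+ n) (+ y) (+ x) (+ p) (int-eq y n x p eq)))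
    ... | Bézout.-+ x y eq = + y , congruent (divides (+ x) (bézout-step′ (+ n) (+ y) (+ x) (+ p) (int-eq x p y n eq)))

    inverse : ∀ z → ¬ z ≈ 0ℤ → ∃ λ w → z * w ≈ 1ℤ
    inverse z z≉0 = let w , nw≈1 = inverse-nat (z %ℕ p) (n%ℕd<d z p) (λ n≈0 → z≉0 (≈-trans z≈n n≈0))
                    in w , ≈-trans (*-cong-≈ z≈n (≡⇒≈ refl)) nw≈1
      where
      z≈n : z ≈ + (z %ℕ p)
      z≈n = congruent (divides (z /ℕ p) (trans (cong (_- + (z %ℕ p)) (a≡a%ℕn+[a/ℕn]*n z p)) (cancel (+ (z %ℕ p)) _)))
        where
        cancel : ∀ r q → r + q - r ≡ q
        cancel = solve-∀

    inv : ℤ → ℤ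
    inv z with z ≈? 0ℤ
    ... | yes _   = 0ℤ
    ... | no  z≉0 = proj₁ (inverse z z≉0)

    *-inv : ∀ z → ¬ z ≈ 0ℤ → z * inv z ≈ 1ℤ
    *-inv z z≉0 with z ≈? 0ℤ
    ... | yes z≈0 = contradiction z≈0 z≉0
    ... | no  z≉0 = proj₂ (inverse z z≉0)

-- Lists without repetition.

∈-∷⁻ : ∀ {a} {A : Set a} {x y : A} {zs} → x ≢ y → y ∈ x ∷ zs → y ∈ zs
∈-∷⁻ x≢y (here refl) = contradiction refl x≢y
∈-∷⁻ x≢y (there y∈)  = y∈

-- Each element of `xs` in turn is moved to the front of `ys`; uniqueness keeps the remaining ones
-- inside what is left.
unique-⊆⇒↭-++ : ∀ {a} {A : Set a} {xs ys : List A} → Unique xs → xs ⊆ ys → ∃ λ zs → ys ↭ xs ++ zs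
unique-⊆⇒↭-++ {xs = []}     {ys} _ _ = ys , ↭-refl
unique-⊆⇒↭-++ {xs = x ∷ xs} (x≢ ∷ uxs) xs⊆ys
  with ls , rs , refl ← ∈-∃++ (xs⊆ys (here refl))
  with zs , p ← unique-⊆⇒↭-++ {ys = ls ++ rs} uxs (λ y∈xs → ∈-∷⁻ (All.lookup x≢ y∈xs) (∈-resp-↭ (shift x ls rs) (xs⊆ys (there y∈xs))))
  = zs , ↭-trans (shift x ls rs) (prep x p)

unique-⊆⇒length≤ : ∀ {a} {A : Set a} {xs ys : List A} → Unique xs → xs ⊆ ys → length xs ℕ.≤ length ys
unique-⊆⇒length≤ {xs = xs} uxs xs⊆ys with zs , p ← unique-⊆⇒↭-++ uxs xs⊆ys =
  subst (length xs ℕ.≤_) (sym (trans (↭-length p) (List.length-++ xs))) (ℕ.m≤m+n _ _)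

unique-⊆⇒↭ : ∀ {a} {A : Set a} {xs ys : List A} → Unique xs → xs ⊆ ys → length xs ≡ length ys → xs ↭ ys
unique-⊆⇒↭ {xs = xs} {ys} uxs xs⊆ys eq with unique-⊆⇒↭-++ uxs xs⊆ys
... | []     , p = ↭-sym (subst (ys ↭_) (List.++-identityʳ xs) p)
... | z ∷ zs , p = contradiction (ℕ.+-cancelˡ-≡ (length xs) 0 _
  (trans (ℕ.+-identityʳ _) (trans eq (trans (↭-length p) (List.length-++ xs))))) λ ()

unique-++⁻ˡ : ∀ {a} {A : Set a} (xs : List A) {ys} → Unique (xs ++ ys) → Unique xs
unique-++⁻ˡ []       _        = []
unique-++⁻ˡ (x ∷ xs) (x≢ ∷ u) = All.++⁻ˡ xs x≢ ∷ unique-++⁻ˡ xs u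

unique-++⁻ʳ : ∀ {a} {A : Set a} (xs : List A) {ys} → Unique (xs ++ ys) → Unique ys
unique-++⁻ʳ []       u       = u
unique-++⁻ʳ (x ∷ xs) (_ ∷ u) = unique-++⁻ʳ xs u

unique-++⇒disjoint : ∀ {a} {A : Set a} (xs : List A) {ys z} → Unique (xs ++ ys) → z ∈ xs → z ∉ ys
unique-++⇒disjoint (x ∷ xs) (x≢ ∷ _) (here refl) z∈ys = All.lookup x≢ (∈-++⁺ʳ xs z∈ys) refl
unique-++⇒disjoint (x ∷ xs) (_ ∷ u)  (there z∈)  z∈ys = unique-++⇒disjoint xs u z∈ z∈ys

allPairs-lookup : ∀ {a r} {A : Set a} {R : A → A → Set r} {xs x y} → (∀ {u v} → R u v → R v u) →
  AllPairs R xs → x ∈ xs → y ∈ xs → x ≡ y ⊎ R x y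
allPairs-lookup s (rs ∷ _) (here refl) (here refl) = inj₁ refl
allPairs-lookup s (rs ∷ _) (here refl) (there y∈)  = inj₂ (All.lookup rs y∈)
allPairs-lookup s (rs ∷ _) (there x∈)  (here refl) = inj₂ (s (All.lookup rs x∈))
allPairs-lookup s (_ ∷ ap) (there x∈)  (there y∈)  = allPairs-lookup s ap x∈ y∈

-- Signed sums and signed permutations.

neg : ℕ → ℤ
neg e = - (+ e)

sumℤ : List ℤ → ℤ
sumℤ = foldr _+_ 0ℤ

sumℤ-↭ : ∀ {xs ys} → xs ↭ ys → sumℤ xs ≡ sumℤ ys
sumℤ-↭ = PermS.foldr-commMonoid (setoid ℤ) ℤ.+-0-isCommutativeMonoid ∘ ↭⇒↭ₛ

-- When `xs` is a signed permutation of positive values `es`, these are the values carrying a plus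
-- sign, that is, the subset behind the signed sum.
positives : List ℤ → List ℕ → List ℕ
positives xs = filter (λ e → + e ∈? xs)

module _ (xs : List ℤ) where

  signed : ℕ → ℤ
  signed e = if does (+ e ∈? xs) then + e else neg e

  -- With all signs negative the sum is `- sum es`, and every plus sign adds back twice its value.
  sum-signed : ∀ es → sumℤ (List.map signed es) ≡ + 2 * + sum (positives xs es) - + sum es
  sum-signed []       = refl
  sum-signed (e ∷ es) with + e ∈? xs
  ... | yes _ = trans (cong (λ z → + e + z) (sum-signed es)) (identity (+ e) (+ sum (positives xs es)) (+ sum es))
    where
    identity : ∀ e f s → e + (+ 2 * f - s) ≡ + 2 * (e + f) - (e + s)
    identity = solve-∀
  ... | no  _ = trans (cong (λ z → neg e + z) (sum-signed es)) (identity (+ e) (+ sum (positives xs es)) (+ sum es))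
    where
    identity : ∀ e f s → - e + (+ 2 * f - s) ≡ + 2 * f - (e + s)
    identity = solve-∀

  signed-pos : ∀ {e} → + e ∈ xs → signed e ≡ + e
  signed-pos {e} e∈ with + e ∈? xs
  ... | yes _  = refl
  ... | no  e∉ = contradiction e∈ e∉

  signed-neg : ∀ {e} → + e ∉ xs → signed e ≡ neg e
  signed-neg {e} e∉ with + e ∈? xs
  ... | yes e∈ = contradiction e∈ e∉
  ... | no  _  = refl

  -- Since no two entries are opposite, each entry is `signed e` for some `e`; a count of entries
  -- then makes `xs` a permutation of `map signed es`.
  signed-permutation-sum : ∀ es → Unique xs → (∀ {x y} → x ∈ xs → y ∈ xs → x + y ≢ 0ℤ) →
    (∀ {x} → x ∈ xs → ∃ λ e → e ∈ es × (x ≡ + e ⊎ x ≡ neg e)) → length xs ≡ length es →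
    sumℤ xs ≡ + 2 * + sum (positives xs es) - + sum es
  signed-permutation-sum es uxs no-opposite ±es len = trans
    (sumℤ-↭ (unique-⊆⇒↭ uxs xs⊆ (trans len (sym (List.length-map signed es)))))
    (sum-signed es)
    where
    xs⊆ : xs ⊆ List.map signed es
    xs⊆ x∈ with ±es x∈
    ... | e , e∈ , inj₁ refl = subst (_∈ _) (signed-pos x∈) (∈-map⁺ signed e∈)
    ... | e , e∈ , inj₂ refl = subst (_∈ _)
      (signed-neg λ +e∈ → no-opposite +e∈ x∈ (ℤ.+-inverseʳ (+ e))) (∈-map⁺ signed e∈)

-- Boxes of admissible signed values.

-- Read es as values in decreasing order.  A coordinate marked true may take ±e for its own e and
-- every smaller e, and -e for the larger ones (collected in prev); one marked false may only take -e
-- for its own and the larger e.  The admissible value that is largest when es really is decreasing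
-- comes first.
top : Bool → ℕ → ℤ
top ε e = if ε then + e else neg e

rest : Bool → ℕ → List ℕ → List ℕ → List ℤ
rest true  e es prev = List.map +_ es ++ List.map neg (e ∷ es ++ prev)
rest false e es prev = List.map neg prev

tops : ∀ {n} → Vec Bool n → Vec ℕ n → Vec ℤ n
tops = Vec.zipWith top

rests : ∀ {n} → List ℕ → Vec Bool n → Vec ℕ n → Vec (List ℤ) n
rests prev []       []       = []
rests prev (ε ∷ εs) (e ∷ es) = rest ε e (toList es) prev ∷ rests (e ∷ prev) εs es

boxes : ∀ {n} → List ℕ → Vec Bool n → Vec ℕ n → Vec (List ℤ) n
boxes prev εs es = Vec.zipWith _∷_ (tops εs es) (rests prev εs es)

Inside : ∀ {n} → Vec ℤ n → Vec (List ℤ) n → Set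
Inside = Pointwise _∈_

-- The asymmetry matters: positive entries come only from the current and later values, never from
-- `prev`, while negative ones may come from all.
data FromBox (es prev : List ℕ) : ℤ → Set where
  positive : ∀ {e} → e ∈ es → FromBox es prev (+ e)
  negative : ∀ {e} → e ∈ es ++ prev → FromBox es prev (neg e)

shift-∈ : ∀ {e prev z} (es : List ℕ) → z ∈ es ++ e ∷ prev → z ∈ e ∷ es ++ prev
shift-∈ es = ∈-resp-↭ (shift _ es _)

∈-box : ∀ ε {e es prev x} → x ∈ top ε e ∷ rest ε e es prev → FromBox (e ∷ es) prev x
∈-box true  (here refl) = positive (here refl)
∈-box true {es = es} (there x∈) with ∈-++⁻ (List.map +_ es) x∈
... | inj₁ m with _ , z∈ , refl ← ∈-map⁻ +_ m = positive (there z∈)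
... | inj₂ m with _ , z∈ , refl ← ∈-map⁻ neg m = negative z∈
∈-box false (here refl) = negative (here refl)
∈-box false {e} {es} (there x∈) with _ , z∈ , refl ← ∈-map⁻ neg x∈ = negative (there (∈-++⁺ʳ es z∈))

∈-box-false : ∀ {e es prev x} → x ∈ top false e ∷ rest false e es prev → ∃ λ z → z ∈ e ∷ prev × x ≡ neg z
∈-box-false (here refl) = _ , here refl , refl
∈-box-false (there x∈) with z , z∈ , eq ← ∈-map⁻ neg x∈ = z , there z∈ , eq

∈-boxes : ∀ {n prev} (εs : Vec Bool n) (es : Vec ℕ n) {xs : Vec ℤ n} → Inside xs (boxes prev εs es) →
  ∀ {x} → x ∈ toList xs → FromBox (toList es) prev x
∈-boxes (ε ∷ εs) (e ∷ es) (x∈ ∷ _)   (here refl) = ∈-box ε x∈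
∈-boxes (ε ∷ εs) (e ∷ es) (_ ∷ xs∈) (there y∈) with ∈-boxes εs es xs∈ y∈
... | positive z∈ = positive (there z∈)
... | negative z∈ = negative (shift-∈ (toList es) z∈)

unique-shift : ∀ {e : ℕ} {prev} es → Unique (e ∷ es ++ prev) → Unique (es ++ e ∷ prev)
unique-shift es = PermS.Unique-resp-↭ (setoid ℕ) (↭⇒↭ₛ (↭-sym (shift _ es _)))

all-shift : ∀ {P : ℕ → Set} {e : ℕ} {prev} es → All P (e ∷ es ++ prev) → All P (es ++ e ∷ prev)
all-shift es = All-resp-↭ (↭-sym (shift _ es _))

trues : ∀ {n} → Vec Bool n → ℕ
trues []       = 0
trues (ε ∷ εs) = (if ε then 1 else 0) ℕ.+ trues εs

pos? : (x : ℤ) → Dec (0ℤ ℤ.< x)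
pos? x = 0ℤ ℤ.<? x

-- A coordinate marked false takes only values `neg z`, so each positive entry uses up a mark.
length-positive-≤ : ∀ {n prev} (εs : Vec Bool n) (es : Vec ℕ n) {xs : Vec ℤ n} →
  Inside xs (boxes prev εs es) → length (filter pos? (toList xs)) ℕ.≤ trues εs
length-positive-≤ []           []       []                = ℕ.z≤n
length-positive-≤ (true  ∷ εs) (e ∷ es) {x ∷ xs} (x∈ ∷ xs∈) with pos? x
... | yes _ = ℕ.s≤s (length-positive-≤ εs es xs∈)
... | no  _ = ℕ.m≤n⇒m≤1+n (length-positive-≤ εs es xs∈)
length-positive-≤ (false ∷ εs) (e ∷ es) {x ∷ xs} (x∈ ∷ xs∈) with pos? x
... | no  _ = length-positive-≤ εs es xs∈
... | yes x>0 with z , _ , refl ← ∈-box-false {es = toList es} x∈ = contradiction x>0 (neg≯0 z)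
  where
  neg≯0 : ∀ z → ¬ 0ℤ ℤ.< neg z
  neg≯0 zero    (ℤ.+<+ ())
  neg≯0 (suc z) ()

-- Distinct positive `e` with `+ e` in the point are distinct positive entries of it.
length-positives-≤ : ∀ {n prev} (εs : Vec Bool n) (es : Vec ℕ n) {xs : Vec ℤ n} →
  Inside xs (boxes prev εs es) → ∀ {zs} → Unique zs → All (0 ℕ.<_) zs →
  length (positives (toList xs) zs) ℕ.≤ trues εs
length-positives-≤ εs es {xs} xs∈ {zs} u zs>0 = ℕ.≤-trans
  (subst (ℕ._≤ _) (List.length-map +_ (positives (toList xs) zs))
    (unique-⊆⇒length≤ (Unique.map⁺ ℤ.+-injective (Unique.filter⁺ P? u)) ⊆pos))
  (length-positive-≤ εs es xs∈)
  where
  P? = λ e → + e ∈? toList xs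
  ⊆pos : List.map +_ (positives (toList xs) zs) ⊆ filter pos? (toList xs)
  ⊆pos x∈ with e , e∈ , refl ← ∈-map⁻ +_ x∈ with e∈zs , +e∈xs ← ∈-filter⁻ P? {xs = zs} e∈ =
    ∈-filter⁺ pos? +e∈xs (ℤ.+<+ (All.lookup zs>0 e∈zs))

all-toList⁺ : ∀ {a p} {A : Set a} {P : A → Set p} {n} (xs : Vec A n) →
  (∀ j → P (lookup xs j)) → All P (toList xs)
all-toList⁺ []       _ = []
all-toList⁺ (x ∷ xs) h = h zero ∷ all-toList⁺ xs (h ∘ suc)

all-toList⁻ : ∀ {a p} {A : Set a} {P : A → Set p} {n} (xs : Vec A n) →
  All P (toList xs) → ∀ j → P (lookup xs j)
all-toList⁻ (x ∷ xs) (px ∷ _)  zero    = px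
all-toList⁻ (x ∷ xs) (_ ∷ pxs) (suc j) = all-toList⁻ xs pxs j

unique-map⁺ : ∀ {a b g r} {A : Set a} {B : Set b} {G : A → Set g} {R : B → B → Set r} {f : A → B} →
  (∀ {x y} → G x → G y → x ≢ y → R (f x) (f y)) →
  ∀ {xs} → All G xs → Unique xs → AllPairs R (List.map f xs)
unique-map⁺ h []        []       = []
unique-map⁺ h (gx ∷ gs) (x≢ ∷ u) =
  All.map⁺ (All.zipWith (λ (gy , x≢y) → h gx gy x≢y) (gs , x≢)) ∷ unique-map⁺ h gs u

-- The sum of the chosen index set. Indices run downward, the first of `suc n` coordinates having
-- index `suc n`, to match values in decreasing order.
weight : ∀ {n} → Vec Bool n → ℕ
weight {zero}  []       = 0
weight {suc n} (ε ∷ εs) = (if ε then suc n else 0) ℕ.+ weight εs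

-- The polynomial `V`, its degree and its zeros on the box.

module Forms (p : ℕ) (p-prime : Prime p) where

  open Modular p public
  open Modular.Inverse p p-prime public
  open DividedDifferences ℤ/p inv *-inv public

  lift : ∀ {n} → LinForm n → LinForm (suc n)
  lift = List.map (map₂ suc)

  evalAffine-lift : ∀ {n} (φ : LinForm n) k x xs → evalAffine (lift φ) k (x ∷ xs) ≡ evalAffine φ k xs
  evalAffine-lift []            k x xs = refl
  evalAffine-lift ((t , i) ∷ φ) k x xs = cong (λ z → t * lookup xs i + z) (evalAffine-lift φ k x xs)

  total : ∀ n → LinForm n
  total zero    = []
  total (suc n) = (1ℤ , zero) ∷ lift (total n)

  evalAffine-total : ∀ {n} k (xs : Vec ℤ n) → evalAffine (total n) k xs ≡ sumℤ (toList xs) + k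
  evalAffine-total k []       = sym (ℤ.+-identityˡ k)
  evalAffine-total k (x ∷ xs) = trans
    (cong₂ _+_ (ℤ.*-identityˡ x) (trans (evalAffine-lift (total _) k x xs) (evalAffine-total k xs)))
    (sym (ℤ.+-assoc x _ k))

  headPair : ∀ {n} → ℤ → Fin n → LinForm (suc n)
  headPair t j = (1ℤ , zero) ∷ (t , suc j) ∷ []

  evalAffine-diff : ∀ {n} (x : ℤ) (xs : Vec ℤ n) j → evalAffine (headPair -1ℤ j) 0ℤ (x ∷ xs) ≡ x - lookup xs j
  evalAffine-diff x xs j = identity x (lookup xs j)
    where
    identity : ∀ x y → 1ℤ * x + (-1ℤ * y + 0ℤ) ≡ x - y
    identity = solve-∀

  evalAffine-sum : ∀ {n} (x : ℤ) (xs : Vec ℤ n) j → evalAffine (headPair 1ℤ j) 0ℤ (x ∷ xs) ≡ x + lookup xs j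
  evalAffine-sum x xs j = identity x (lookup xs j)
    where
    identity : ∀ x y → 1ℤ * x + (1ℤ * y + 0ℤ) ≡ x + y
    identity = solve-∀

  -- The first coordinate has the largest index, so its own mark decides whether the sums with all
  -- later coordinates enter `V`.
  headPairs : Bool → ∀ n → List (LinForm (suc n))
  headPairs ε n = List.map (headPair -1ℤ) (allFin n) ++ (if ε then List.map (headPair 1ℤ) (allFin n) else [])

  pairForms : ∀ {n} → Vec Bool n → List (LinForm n)
  pairForms []               = []
  pairForms {suc n} (ε ∷ εs) = headPairs ε n ++ List.map lift (pairForms εs)

  -- For empty `prev`, the sum of (box size - 1) is `weight εs` plus the degree of `V`: exactly
  -- enough for `weight εs` further linear factors. Passing `e` to `prev` accounts for the last
  -- summand.
  totalLength-boxes : ∀ {n} prev (εs : Vec Bool n) es →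
    totalLength (boxes prev εs es) ≡ weight εs ℕ.+ length (pairForms εs) ℕ.+ n ℕ.+ n ℕ.* length prev
  totalLength-boxes         prev []           []       = refl
  totalLength-boxes {suc n} prev (true ∷ εs)  (e ∷ es)
    rewrite totalLength-boxes (e ∷ prev) εs es
          | List.length-++ (List.map +_ (toList es)) {List.map neg (e ∷ toList es ++ prev)}
          | List.length-map +_ (toList es)
          | List.length-map neg (toList es ++ prev)
          | List.length-++ (toList es) {prev}
          | Vec.length-toList es
          | List.length-++ (headPairs true n) {List.map lift (pairForms εs)}
          | List.length-++ (List.map (headPair -1ℤ) (allFin n)) {List.map (headPair 1ℤ) (allFin n)}
          | List.length-map (headPair -1ℤ) (allFin n)
          | List.length-map (headPair 1ℤ) (allFin n)
          | List.length-map lift (pairForms εs)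
          | List.length-tabulate {n = n} (λ i → i)
          = identity n (weight εs) (length (pairForms εs)) (length prev)
    where
    identity : ∀ n w v q →
      suc (n ℕ.+ suc (n ℕ.+ q)) ℕ.+ (w ℕ.+ v ℕ.+ n ℕ.+ n ℕ.* suc q) ≡
      suc n ℕ.+ w ℕ.+ (n ℕ.+ n ℕ.+ v) ℕ.+ suc n ℕ.+ suc n ℕ.* q
    identity = ℕ-Solver.solve-∀
  totalLength-boxes {suc n} prev (false ∷ εs) (e ∷ es)
    rewrite totalLength-boxes (e ∷ prev) εs es
          | List.length-map neg prev
          | List.length-++ (headPairs false n) {List.map lift (pairForms εs)}
          | List.length-++ (List.map (headPair -1ℤ) (allFin n)) {[]}
          | List.length-map (headPair -1ℤ) (allFin n)
          | List.length-map lift (pairForms εs)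
          | List.length-tabulate {n = n} (λ i → i)
          = identity n (weight εs) (length (pairForms εs)) (length prev)
    where
    identity : ∀ n w v q →
      suc q ℕ.+ (w ℕ.+ v ℕ.+ n ℕ.+ n ℕ.* suc q) ≡
      w ℕ.+ (n ℕ.+ 0 ℕ.+ v) ℕ.+ suc n ℕ.+ suc n ℕ.* q
    identity = ℕ-Solver.solve-∀

  sameLengths-boxes : ∀ {n} prev prev′ (εs : Vec Bool n) es es′ → length prev ≡ length prev′ →
    SameLengths (boxes prev εs es) (boxes prev′ εs es′)
  sameLengths-boxes prev prev′ []       []       []         eq = []
  sameLengths-boxes {suc n} prev prev′ (ε ∷ εs) (e ∷ es) (e′ ∷ es′) eq =
    head-eq ε ∷ sameLengths-boxes (e ∷ prev) (e′ ∷ prev′) εs es es′ (cong suc eq)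
    where
    length-true : ∀ e (es : Vec ℕ n) prev → length (rest true e (toList es) prev) ≡ n ℕ.+ suc (n ℕ.+ length prev)
    length-true e es prev = trans (List.length-++ (List.map +_ (toList es)))
      (cong₂ ℕ._+_ (trans (List.length-map +_ (toList es)) (Vec.length-toList es))
        (cong suc (trans (List.length-map neg (toList es ++ prev))
          (trans (List.length-++ (toList es)) (cong (ℕ._+ length prev) (Vec.length-toList es))))))
    head-eq : ∀ ε → length (top ε e ∷ rest ε e (toList es) prev) ≡ length (top ε e′ ∷ rest ε e′ (toList es′) prev′)
    head-eq true  = cong suc (trans (length-true e es prev)
      (trans (cong (λ q → n ℕ.+ suc (n ℕ.+ q)) eq) (sym (length-true e′ es′ prev′))))
    head-eq false = cong suc (trans (List.length-map neg prev) (trans eq (sym (List.length-map neg prev′))))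

  -- The factors are tested as integers, so that signs can be read off; an integer zero is still a
  -- zero modulo `p`.
  NonDegenerate : ∀ {n} → Vec Bool n → Vec ℤ n → Set
  NonDegenerate εs xs = All (λ φ → evalAffine φ 0ℤ xs ≢ 0ℤ) (pairForms εs)

  -- The factors of `V` exclude equal entries, and opposite ones when the earlier coordinate is
  -- marked. An unmarked entry is `neg z` with z in `e ∷ prev`: a later positive entry comes from
  -- `es`, disjoint from this list, and a later negative one makes the sum negative.
  nonDegenerate⇒pairs : ∀ {n prev} (εs : Vec Bool n) es {xs} →
    Unique (toList es ++ prev) → All (0 ℕ.<_) (toList es ++ prev) →
    Inside xs (boxes prev εs es) → NonDegenerate εs xs →
    AllPairs (λ x y → x ≢ y × x + y ≢ 0ℤ) (toList xs)
  nonDegenerate⇒pairs []       []       u >0 []              nd = []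
  nonDegenerate⇒pairs {suc n} {prev} (ε ∷ εs) (e ∷ es) {x ∷ xs} u >0 (x∈ ∷ xs∈) nd =
    All.zip (all-toList⁺ xs x≢ , sums ε x∈ (All.++⁻ʳ (List.map (headPair -1ℤ) (allFin n)) heads)) ∷
    nonDegenerate⇒pairs εs es (unique-shift (toList es) u) (all-shift (toList es) >0) xs∈
      (All.map (λ {φ} nz eq → nz (trans (evalAffine-lift φ 0ℤ x xs) eq))
        (All.map⁻ (All.++⁻ʳ (headPairs ε n) nd)))
    where
    heads : All (λ φ → evalAffine φ 0ℤ (x ∷ xs) ≢ 0ℤ) (headPairs ε n)
    heads = All.++⁻ˡ (headPairs ε n) nd
    x≢ : ∀ j → x ≢ lookup xs j
    x≢ j eq = All.lookup (All.map⁻ (All.++⁻ˡ (List.map (headPair -1ℤ) (allFin n)) heads)) (∈-allFin j)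
      (trans (evalAffine-diff x xs j) (ℤ.i≡j⇒i-j≡0 eq))
    sums : ∀ ε → x ∈ top ε e ∷ rest ε e (toList es) prev →
      All (λ φ → evalAffine φ 0ℤ (x ∷ xs) ≢ 0ℤ) (if ε then List.map (headPair 1ℤ) (allFin n) else []) →
      All (λ y → x + y ≢ 0ℤ) (toList xs)
    sums true  _  nz = all-toList⁺ xs λ j eq →
      All.lookup (All.map⁻ nz) (∈-allFin j) (trans (evalAffine-sum x xs j) eq)
    sums false x∈ _ with z , z∈ , refl ← ∈-box-false {es = toList es} x∈ = All.tabulate λ y∈ → no-cancel (∈-boxes εs es xs∈ y∈)
      where
      no-cancel : ∀ {y} → FromBox (toList es) (e ∷ prev) y → neg z + y ≢ 0ℤ
      no-cancel (positive {w} w∈) eq = unique-++⇒disjoint (toList es) (unique-shift (toList es) u) w∈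
        (subst (_∈ e ∷ prev) (sym (ℤ.+-injective (ℤ.i-j≡0⇒i≡j (+ w) (+ z) (trans (ℤ.+-comm (+ w) (neg z)) eq)))) z∈)
      no-cancel (negative {w} w∈) eq = ℕ.<⇒≢
        (All.lookup (all-shift (toList es) >0) (∈-++⁺ʳ (toList es) z∈))
        (sym (ℕ.m+n≡0⇒m≡0 z (ℤ.+-injective (ℤ.neg-injective (trans (ℤ.neg-distrib-+ (+ z) (+ w)) eq)))))

  module _ {n} {εs : Vec Bool n} {es : Vec ℕ n} {xs : Vec ℤ n}
    (u : Unique (toList es)) (>0 : All (0 ℕ.<_) (toList es))
    (xs∈ : Inside xs (boxes [] εs es)) (nd : NonDegenerate εs xs) where

    private
      ++[] : toList es ++ [] ≡ toList es
      ++[] = List.++-identityʳ (toList es)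

      pairs : AllPairs (λ x y → x ≢ y × x + y ≢ 0ℤ) (toList xs)
      pairs = nonDegenerate⇒pairs εs es (subst Unique (sym ++[]) u) (subst (All (0 ℕ.<_)) (sym ++[]) >0) xs∈ nd

      ±es : ∀ {x} → x ∈ toList xs → ∃ λ e → e ∈ toList es × (x ≡ + e ⊎ x ≡ neg e)
      ±es x∈ with ∈-boxes εs es xs∈ x∈
      ... | positive {e} e∈ = e , e∈ , inj₁ refl
      ... | negative {e} e∈ = e , subst (e ∈_) ++[] e∈ , inj₂ refl

      double≢0 : ∀ {x} → x ∈ toList xs → x + x ≢ 0ℤ
      double≢0 x∈ eq with ±es x∈
      ... | e , e∈ , inj₁ refl = ℕ.<⇒≢ (All.lookup >0 e∈) (sym (ℕ.m+n≡0⇒m≡0 e (ℤ.+-injective eq)))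
      ... | e , e∈ , inj₂ refl = ℕ.<⇒≢ (All.lookup >0 e∈)
        (sym (ℕ.m+n≡0⇒m≡0 e (ℤ.+-injective (ℤ.neg-injective (trans (ℤ.neg-distrib-+ (+ e) (+ e)) eq)))))

      no-opposite : ∀ {x y} → x ∈ toList xs → y ∈ toList xs → x + y ≢ 0ℤ
      no-opposite x∈ y∈ with allPairs-lookup (λ {x} {y} (≢ , +≢) → ≢ ∘ sym , +≢ ∘ trans (ℤ.+-comm x y)) pairs x∈ y∈
      ... | inj₁ refl      = double≢0 x∈
      ... | inj₂ (_ , +≢0) = +≢0

    -- Such a point is a signed permutation of `es`: its entries are distinct, nonzero, and no two
    -- are opposite.
    nonDegenerate-sum : sumℤ (toList xs) ≡ + 2 * + sum (positives (toList xs) (toList es)) - + sum (toList es)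
    nonDegenerate-sum = signed-permutation-sum (toList xs) (toList es)
      (AllPairs.map proj₁ pairs) no-opposite ±es (trans (Vec.length-toList xs) (sym (Vec.length-toList es)))

  -- All residues `a` and `- a` with `a` in `G` are distinct; the case `a = b` of `sum≉0` keeps `a`
  -- apart from `- a`. This is used for `A` and for the model values 1, ..., n.
  record Separated (G : ℕ → Set) : Set where
    field
      difference≉0 : ∀ {a b} → G a → G b → a ≢ b → ¬ + a - + b ≈ 0ℤ
      sum≉0        : ∀ {a b} → G a → G b → ¬ + a + + b ≈ 0ℤ

  module _ {G : ℕ → Set} (sep : Separated G) where

    open Separated sep

    private
      negated : ∀ {x y} → x ≡ - y → ¬ y ≈ 0ℤ → ¬ x ≈ 0ℤ
      negated {y = y} refl y≉0 -y≈0 = y≉0 (≈-trans (≡⇒≈ (sym (ℤ.neg-involutive y))) (-‿cong-≈ -y≈0))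

      equal : ∀ {x y} → x ≡ y → ¬ y ≈ 0ℤ → ¬ x ≈ 0ℤ
      equal refl h = h

      -a-b : ∀ a b → - a - b ≡ - (a + b)
      -a-b = solve-∀

      -a+b : ∀ a b → - a + b ≡ - (a - b)
      -a+b = solve-∀

      a-[-b] : ∀ a b → a - - b ≡ a + b
      a-[-b] = solve-∀

    pos-neg≉0 : ∀ {a b} → G a → G b → ¬ + a - neg b ≈ 0ℤ
    pos-neg≉0 {a} {b} ga gb = equal (a-[-b] (+ a) (+ b)) (sum≉0 ga gb)

    neg-neg≉0 : ∀ {a b} → G a → G b → a ≢ b → ¬ neg a - neg b ≈ 0ℤ
    neg-neg≉0 {a} {b} ga gb a≢b = negated (trans (a-[-b] (neg a) (+ b)) (-a+b (+ a) (+ b))) (difference≉0 ga gb a≢b)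

    top-difference≉0 : ∀ ε ε′ {a b} → G a → G b → a ≢ b → ¬ top ε a - top ε′ b ≈ 0ℤ
    top-difference≉0 true  true          ga gb a≢b = difference≉0 ga gb a≢b
    top-difference≉0 true  false         ga gb a≢b = pos-neg≉0 ga gb
    top-difference≉0 false true  {a} {b} ga gb a≢b = negated (-a-b (+ a) (+ b)) (sum≉0 ga gb)
    top-difference≉0 false false         ga gb a≢b = neg-neg≉0 ga gb a≢b

    top-sum≉0 : ∀ ε ε′ {a b} → G a → G b → a ≢ b → ¬ top ε a + top ε′ b ≈ 0ℤ
    top-sum≉0 true  true          ga gb a≢b = sum≉0 ga gb
    top-sum≉0 true  false         ga gb a≢b = difference≉0 ga gb a≢b
    top-sum≉0 false true  {a} {b} ga gb a≢b = negated (-a+b (+ a) (+ b)) (difference≉0 ga gb a≢b)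
    top-sum≉0 false false {a} {b} ga gb a≢b = negated (-a-b (+ a) (+ b)) (sum≉0 ga gb)

    distinct-box : ∀ ε {e es prev} → All G (e ∷ es ++ prev) → Unique (e ∷ es ++ prev) →
      Distinct (top ε e ∷ rest ε e es prev)
    -- By computation the box is the list of positives from `e ∷ es` followed by the negatives from
    -- `e ∷ es ++ prev`.
    distinct-box true {e} {es} {prev} g u = AllPairs.++⁺
      (unique-map⁺ difference≉0 (All.++⁻ˡ (e ∷ es) g) (unique-++⁻ˡ (e ∷ es) u))
      (unique-map⁺ neg-neg≉0 g u)
      (All.map⁺ (All.map (λ ga → All.map⁺ (All.map (pos-neg≉0 ga) g)) (All.++⁻ˡ (e ∷ es) g)))
    distinct-box false {e} {es} g u = unique-map⁺ neg-neg≉0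
      (All.++⁻ʳ es (all-shift es g)) (unique-++⁻ʳ es (unique-shift es u))

    distinct-boxes : ∀ {n prev} (εs : Vec Bool n) es → All G (toList es ++ prev) → Unique (toList es ++ prev) →
      VAll.All Distinct (boxes prev εs es)
    distinct-boxes []       []       g u = []
    distinct-boxes (ε ∷ εs) (e ∷ es) g u = distinct-box ε g u ∷
      distinct-boxes εs es (all-shift (toList es) g) (unique-shift (toList es) u)

    -- The top corner consists of distinct values with signs, so every factor is, up to sign, a sum
    -- or a difference of two distinct values.
    pairForms-tops : ∀ {n} (εs : Vec Bool n) es → All G (toList es) → Unique (toList es) →
      All (λ φ → ¬ evalAffine φ 0ℤ (tops εs es) ≈ 0ℤ) (pairForms εs)
    pairForms-tops []       []       _        _        = []
    pairForms-tops {suc n} (ε ∷ εs) (e ∷ es) (g ∷ gs) (e≢ ∷ u) = All.++⁺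
      (All.++⁺ (All.map⁺ (All.universal differences (allFin n))) (sums ε))
      (All.map⁺ (All.map (λ {φ} → equal (evalAffine-lift φ 0ℤ (top ε e) (tops εs es))) (pairForms-tops εs es gs u)))
      where
      differences : ∀ j → ¬ evalAffine (headPair -1ℤ j) 0ℤ (tops (ε ∷ εs) (e ∷ es)) ≈ 0ℤ
      differences j = equal
        (trans (evalAffine-diff (top ε e) (tops εs es) j)
          (cong (λ y → top ε e - y) (Vec.lookup-zipWith top j εs es)))
        (top-difference≉0 ε (lookup εs j) g (all-toList⁻ es gs j) (all-toList⁻ es e≢ j))
      sums : ∀ ε′ → All (λ φ → ¬ evalAffine φ 0ℤ (tops (ε ∷ εs) (e ∷ es)) ≈ 0ℤ)
        (if ε′ then List.map (headPair 1ℤ) (allFin n) else [])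
      sums false = []
      sums true  = All.map⁺ (All.universal (λ j → equal
        (trans (evalAffine-sum (top ε e) (tops εs es) j)
          (cong (λ y → top ε e + y) (Vec.lookup-zipWith top j εs es)))
        (top-sum≉0 ε (lookup εs j) g (all-toList⁻ es gs j) (all-toList⁻ es e≢ j))) (allFin n))

  -- The polynomial `V · ∏ (Σ x - c)` as a list of affine factors; the `c` enter only through the
  -- constants.
  factors : ∀ {n} → List ℤ → Vec Bool n → List (LinForm n × ℤ)
  factors {n} cs εs = List.map (λ c → total n , - c) cs ++ List.map (_, 0ℤ) (pairForms εs)

  forms-factors : ∀ {n} cs cs′ (εs : Vec Bool n) → length cs ≡ length cs′ →
    List.map proj₁ (factors cs εs) ≡ List.map proj₁ (factors cs′ εs)
  forms-factors []       []         εs eq = refl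
  forms-factors (c ∷ cs) (c′ ∷ cs′) εs eq = cong (total _ ∷_) (forms-factors cs cs′ εs (ℕ.suc-injective eq))

  length-factors : ∀ {n} cs (εs : Vec Bool n) → length (factors cs εs) ≡ length cs ℕ.+ length (pairForms εs)
  length-factors cs εs = trans (List.length-++ (List.map _ cs))
    (cong₂ ℕ._+_ (List.length-map _ cs) (List.length-map _ (pairForms εs)))

  product-zero : ∀ {n} (F : List (LinForm n × ℤ)) xs {φ k} → (φ , k) ∈ F →
    evalAffine φ k xs ≈ 0ℤ → product F xs ≈ 0ℤ
  product-zero (_ ∷ F) xs (here refl) e≈0 = ≈-trans (*-cong-≈ e≈0 (≡⇒≈ {product F xs} refl)) (≡⇒≈ (ℤ.*-zeroˡ (product F xs)))
  product-zero ((ψ , l) ∷ F) xs (there φ∈) e≈0 = ≈-trans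
    (*-cong-≈ (≡⇒≈ {evalAffine ψ l xs} refl) (product-zero F xs φ∈ e≈0)) (≡⇒≈ (ℤ.*-zeroʳ (evalAffine ψ l xs)))

  product-nonzero : ∀ {n} (F : List (LinForm n × ℤ)) xs →
    All (λ (φ , k) → ¬ evalAffine φ k xs ≈ 0ℤ) F → ¬ product F xs ≈ 0ℤ
  product-nonzero []      xs []       = 0<n<p⇒≉0 ℕ.z<s (ℕ.nonTrivial⇒n>1 p {{prime⇒nonTrivial p-prime}})
  product-nonzero (_ ∷ F) xs (h ∷ hs) = nonzero-* h (product-nonzero F xs hs)

  -- A degenerate point kills a factor of `V`; at any other point the sum is congruent to some `c`,
  -- which kills `Σ x - c`.
  factors-vanish : ∀ {n} cs (εs : Vec Bool n) xs →
    (NonDegenerate εs xs → ∃ λ c → c ∈ cs × sumℤ (toList xs) ≈ c) → product (factors cs εs) xs ≈ 0ℤ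
  factors-vanish {n} cs εs xs covered with All.all? (λ φ → ¬? (evalAffine φ 0ℤ xs ℤ.≟ 0ℤ)) (pairForms εs)
  ... | yes nd with c , c∈ , Σ≈c ← covered nd = product-zero (factors cs εs) xs
    (∈-++⁺ˡ (∈-map⁺ (λ c → total n , - c) c∈))
    (≈-trans (≡⇒≈ (evalAffine-total (- c) xs))
      (≈-trans (+-cong-≈ Σ≈c (≡⇒≈ { - c} refl)) (≡⇒≈ (ℤ.+-inverseʳ c))))
  ... | no ¬nd with φ , φ∈ , ¬¬0 ← find (All.¬All⇒Any¬ (λ φ → ¬? (evalAffine φ 0ℤ xs ℤ.≟ 0ℤ)) (pairForms εs) ¬nd) =
    product-zero (factors cs εs) xs (∈-++⁺ʳ (List.map _ cs) (∈-map⁺ (_, 0ℤ) φ∈))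
      (≡⇒≈ (decidable-stable (evalAffine φ 0ℤ xs ℤ.≟ 0ℤ) ¬¬0))

-- The model values n, ..., 1 and their top corner.

descending : ∀ n → Vec ℕ n
descending zero    = []
descending (suc n) = suc n ∷ descending n

descending-bounds : ∀ n → All (λ m → 0 ℕ.< m × m ℕ.≤ n) (toList (descending n))
descending-bounds zero    = []
descending-bounds (suc n) = (ℕ.z<s , ℕ.≤-refl) ∷ All.map (map₂ ℕ.m≤n⇒m≤1+n) (descending-bounds n)

descending-unique : ∀ n → Unique (toList (descending n))
descending-unique zero    = []
descending-unique (suc n) =
  All.map (λ (_ , m≤n) → ℕ.<⇒≢ (s≤s m≤n) ∘ sym) (descending-bounds n) ∷ descending-unique n

-- At the top corner the plus signs sit exactly at the marked indices, whose sum is `weight εs`.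
sum-tops : ∀ {n} (εs : Vec Bool n) →
  sumℤ (toList (tops εs (descending n))) ≡ + 2 * + weight εs - + sum (toList (descending n))
sum-tops []                   = refl
sum-tops {suc n} (true ∷ εs)  = trans (cong (λ z → + suc n + z) (sum-tops εs))
  (identity (+ suc n) (+ weight εs) (+ sum (toList (descending n))))
  where
  identity : ∀ e f s → e + (+ 2 * f - s) ≡ + 2 * (e + f) - (e + s)
  identity = solve-∀
sum-tops {suc n} (false ∷ εs) = trans (cong (λ z → neg (suc n) + z) (sum-tops εs))
  (identity (+ suc n) (+ weight εs) (+ sum (toList (descending n))))
  where
  identity : ∀ e f s → - e + (+ 2 * f - s) ≡ + 2 * f - (e + s)
  identity = solve-∀

-- A marked box has `suc n` as its largest value; in an unmarked one all other entries are negatives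
-- of larger numbers.
box≤top : ∀ {n prev x} ε → All (suc n ℕ.<_) prev →
  x ∈ top ε (suc n) ∷ rest ε (suc n) (toList (descending n)) prev → x ℤ.≤ top ε (suc n)
box≤top {n} true _ x∈ with ∈-box true x∈
... | positive e∈ = ℤ.+≤+ (proj₂ (All.lookup (descending-bounds (suc n)) e∈))
... | negative _  = ℤ.neg-≤-pos
box≤top {n} false prev> x∈ with ∈-box-false {es = toList (descending n)} x∈
... | z , here refl , refl = ℤ.≤-refl
... | z , there z∈  , refl = ℤ.neg-mono-≤ (ℤ.+≤+ (ℕ.<⇒≤ (All.lookup prev> z∈)))

boxes≤tops : ∀ {n prev} (εs : Vec Bool n) {xs : Vec ℤ n} → All (n ℕ.<_) prev →
  Inside xs (boxes prev εs (descending n)) → Pointwise ℤ._≤_ xs (tops εs (descending n))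
boxes≤tops []       _     []         = []
boxes≤tops {suc n} (ε ∷ εs) prev> (x∈ ∷ xs∈) = box≤top ε prev> x∈ ∷
  boxes≤tops εs (ℕ.n<1+n n ∷ All.map (ℕ.<-trans (ℕ.n<1+n n)) prev>) xs∈

≤⇒≡⊎sum< : ∀ {n} {xs ys : Vec ℤ n} → Pointwise ℤ._≤_ xs ys → xs ≡ ys ⊎ sumℤ (toList xs) ℤ.< sumℤ (toList ys)
≤⇒≡⊎sum< [] = inj₁ refl
≤⇒≡⊎sum< {xs = x ∷ _} {y ∷ _} (x≤y ∷ xs≤ys) with ≤⇒≡⊎sum< xs≤ys | x ℤ.≟ y
... | inj₂ lt   | _        = inj₂ (ℤ.+-mono-≤-< x≤y lt)
... | inj₁ refl | yes refl = inj₁ refl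
... | inj₁ refl | no  x≢y  = inj₂ (ℤ.+-monoˡ-< _ (ℤ.≤∧≢⇒< x≤y x≢y))

-- Index sets of prescribed sum.

-- The greatest weight that at most `h` marks on `n` coordinates can have.
topSum : ℕ → ℕ → ℕ
topSum (suc n) (suc h) = suc n ℕ.+ topSum n h
topSum _       _       = 0

n≤topSum : ∀ n h → n ℕ.≤ topSum n (suc h)
n≤topSum zero    h = z≤n
n≤topSum (suc n) h = ℕ.m≤m+n (suc n) _

-- Greedy choice: the largest index is taken whenever it fits into `s`. If it does not, then
-- `s ≤ n`, which a single mark on the smaller indices can already reach.
select : ∀ n h s → s ℕ.≤ topSum n h → ∃ λ (εs : Vec Bool n) → weight εs ≡ s × trues εs ℕ.≤ h
select zero    h       zero s≤ = [] , refl , z≤n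
select (suc n) zero    zero s≤ with εs , w , t ← select n zero zero z≤n = false ∷ εs , w , t
select (suc n) (suc h) s    s≤ with suc n ℕ.≤? s
... | yes n<s with εs , w , t ← select n h (s ℕ.∸ suc n) (ℕ.m≤n+o⇒m∸n≤o s (suc n) s≤) =
  true ∷ εs , trans (cong (suc n ℕ.+_) w) (ℕ.m+[n∸m]≡n n<s) , s≤s t
... | no  n≮s with εs , w , t ← select n (suc h) s (ℕ.≤-trans (ℕ.s≤s⁻¹ (ℕ.≰⇒> n≮s)) (n≤topSum n h)) =
  false ∷ εs , w , t

-- Twice the sum of α + 1, ..., h + α, written without subtraction or division.
double-topSum : ∀ α h → 2 ℕ.* topSum (h ℕ.+ α) h ℕ.+ α ℕ.* (α ℕ.+ 1) ≡ (h ℕ.+ α) ℕ.* (h ℕ.+ α ℕ.+ 1)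
double-topSum α zero    = no-summands α
  where
  no-summands : ∀ α → 2 ℕ.* topSum α 0 ℕ.+ α ℕ.* (α ℕ.+ 1) ≡ α ℕ.* (α ℕ.+ 1)
  no-summands zero    = refl
  no-summands (suc α) = refl
double-topSum α (suc h) = begin
  2 ℕ.* (suc d ℕ.+ T) ℕ.+ α ℕ.* (α ℕ.+ 1)   ≡⟨ rearrange d T (α ℕ.* (α ℕ.+ 1)) ⟩
  2 ℕ.* suc d ℕ.+ (2 ℕ.* T ℕ.+ α ℕ.* (α ℕ.+ 1)) ≡⟨ cong (2 ℕ.* suc d ℕ.+_) (double-topSum α h) ⟩
  2 ℕ.* suc d ℕ.+ d ℕ.* (d ℕ.+ 1)           ≡⟨ square d ⟩
  suc d ℕ.* (suc d ℕ.+ 1)                   ∎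
  where
  open ≡-Reasoning
  d = h ℕ.+ α
  T = topSum d h
  rearrange : ∀ d T z → 2 ℕ.* (suc d ℕ.+ T) ℕ.+ z ≡ 2 ℕ.* suc d ℕ.+ (2 ℕ.* T ℕ.+ z)
  rearrange = ℕ-Solver.solve-∀
  square : ∀ d → 2 ℕ.* suc d ℕ.+ d ℕ.* (d ℕ.+ 1) ≡ suc d ℕ.* (suc d ℕ.+ 1)
  square = ℕ-Solver.solve-∀

-- Comparison of coefficients with the model box.

module Key (p : ℕ) (p-prime : Prime p) where

  open Forms p p-prime public

  interval-separated : ∀ n → 2 ℕ.* n ℕ.< p → Separated (λ m → 0 ℕ.< m × m ℕ.≤ n)
  interval-separated n 2n<p = record
    { difference≉0 = λ {a} {b} (_ , a≤n) (_ , b≤n) a≢b a-b≈0 →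
        a≢b (<p⇒≡ (<p a≤n) (<p b≤n) (≈-difference⇒≈ a-b≈0))
    ; sum≉0 = λ {a} {b} (0<a , a≤n) (_ , b≤n) → 0<n<p⇒≉0
        (ℕ.<-≤-trans 0<a (ℕ.m≤m+n a b))
        (ℕ.≤-<-trans (subst (a ℕ.+ b ℕ.≤_) (cong (n ℕ.+_) (sym (ℕ.+-identityʳ n))) (ℕ.+-mono-≤ a≤n b≤n)) 2n<p)
    }
    where
    <p : ∀ {m} → m ℕ.≤ n → m ℕ.< p
    <p m≤n = ℕ.≤-<-trans m≤n (ℕ.≤-<-trans (ℕ.m≤m+n n _) 2n<p)

  module Model {n} (εs : Vec Bool n) (s<p : weight εs ℕ.< p) (2n<p : 2 ℕ.* n ℕ.< p) where

    σ s : ℕ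
    σ = sum (toList (descending n))
    s = weight εs

    target : ℕ → ℤ
    target t = + 2 * + t - + σ

    -- The signed sums with t = 0, ..., s - 1, that is, the `s` terms of the progression just below
    -- the top value t = s.
    targets : List ℤ
    targets = List.map target (upTo s)

    -- Any other nondegenerate point has a smaller sum than the top corner, so its subset sum `t` is
    -- below `s`.
    vanishes-below-top : ∀ xs → Inside xs (boxes [] εs (descending n)) → xs ≢ tops εs (descending n) →
      product (factors targets εs) xs ≈ 0ℤ
    vanishes-below-top xs xs∈ xs≢ = factors-vanish targets εs xs covered
      where
      covered : NonDegenerate εs xs → ∃ λ c → c ∈ targets × sumℤ (toList xs) ≈ c
      covered nd with ≤⇒≡⊎sum< (boxes≤tops εs [] xs∈)
      ... | inj₁ xs≡ = contradiction xs≡ xs≢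
      ... | inj₂ lt = target t , ∈-map⁺ target (∈-upTo⁺ t<s) , ≡⇒≈ Σ≡
        where
        t : ℕ
        t = sum (positives (toList xs) (toList (descending n)))
        Σ≡ : sumℤ (toList xs) ≡ target t
        Σ≡ = nonDegenerate-sum (descending-unique n) (All.map proj₁ (descending-bounds n)) xs∈ nd
        t<s : t ℕ.< s
        t<s = ℕ.≰⇒> λ s≤t → ℤ.<⇒≱ (subst₂ ℤ._<_ Σ≡ (sum-tops εs) lt)
          (ℤ.+-monoˡ-≤ (neg σ) (ℤ.*-monoˡ-≤-nonNeg (+ 2) (ℤ.+≤+ s≤t)))

    2k≉0 : ∀ k → 0 ℕ.< k → k ℕ.≤ s → ¬ + (2 ℕ.* k) ≈ 0ℤ
    2k≉0 k 0<k k≤s 2k≈0 with euclidsLemma 2 k p-prime (≈0⇒∣ 2k≈0)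
    ... | inj₂ p∣k = 0<n<p⇒≉0 0<k (ℕ.≤-<-trans k≤s s<p) (∣⇒≈0 p∣k)
    -- If `p` divides 2, then `2 n < p` leaves no coordinates, so the weight is 0.
    ... | inj₁ p∣2 = no-room εs (ℕ.<-≤-trans 2n<p (ℕ.∣⇒≤ p∣2)) (ℕ.<-≤-trans 0<k k≤s)
      where
      no-room : ∀ {n} (εs : Vec Bool n) → 2 ℕ.* n ℕ.< 2 → ¬ 0 ℕ.< weight εs
      no-room []               _    ()
      no-room {suc n} (_ ∷ εs) 2n<2 _ = ℕ.<⇒≱ 2n<2 (ℕ.*-monoʳ-≤ 2 (s≤s z≤n))

    -- The factors of `V` are nonzero there, and the factor for `t` has the value `2 (s - t)` with
    -- `0 < s - t < p`.
    nonzero-at-top : ¬ product (factors targets εs) (tops εs (descending n)) ≈ 0ℤ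
    nonzero-at-top = product-nonzero (factors targets εs) (tops εs (descending n)) (All.++⁺
      (All.map⁺ (All.map⁺ (All.tabulate λ t∈ → total≉0 (∈-upTo⁻ t∈))))
      (All.map⁺ (pairForms-tops (interval-separated n 2n<p) εs (descending n) (descending-bounds n) (descending-unique n))))
      where
      identity : ∀ t k σ → + 2 * (t + k) - σ + - (+ 2 * t - σ) ≡ + 2 * k
      identity = solve-∀
      total≡ : ∀ {t} → t ℕ.< s → evalAffine (total n) (- target t) (tops εs (descending n)) ≡ + (2 ℕ.* (s ℕ.∸ t))
      total≡ {t} t<s = begin
        evalAffine (total n) (- target t) (tops εs (descending n))
          ≡⟨ evalAffine-total (- target t) (tops εs (descending n)) ⟩
        sumℤ (toList (tops εs (descending n))) + - target t
          ≡⟨ cong (_- target t) (trans (sum-tops εs) (cong (λ s → + 2 * + s - + σ) (sym (ℕ.m+[n∸m]≡n (ℕ.<⇒≤ t<s))))) ⟩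
        + 2 * (+ t + + (s ℕ.∸ t)) - + σ - (+ 2 * + t - + σ)
          ≡⟨ identity (+ t) (+ (s ℕ.∸ t)) (+ σ) ⟩
        + 2 * + (s ℕ.∸ t)
          ≡⟨ ℤ.pos-* 2 (s ℕ.∸ t) ⟨
        + (2 ℕ.* (s ℕ.∸ t)) ∎
        where open ≡-Reasoning
      total≉0 : ∀ {t} → t ℕ.< s → ¬ evalAffine (total n) (- target t) (tops εs (descending n)) ≈ 0ℤ
      total≉0 {t} t<s ≈0 = 2k≉0 (s ℕ.∸ t) (ℕ.m<n⇒0<n∸m t<s) (ℕ.m∸n≤m s t) (≈-trans (≡⇒≈ (sym (total≡ t<s))) ≈0)

  -- If the `cs` caught all sums, the polynomial would vanish on the box of `es` and its coefficient
  -- would be 0. The model polynomial has the same leading forms and box sizes, hence the same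
  -- coefficient, but that one is nonzero.
  uncoverable : ∀ {n} (εs : Vec Bool n) (es : Vec ℕ n) (cs : List ℤ) {G : ℕ → Set} →
    Separated G → All G (toList es) → Unique (toList es) →
    length cs ≡ weight εs → weight εs ℕ.< p → 2 ℕ.* n ℕ.< p →
    ¬ (∀ xs → Inside xs (boxes [] εs es) → NonDegenerate εs xs → ∃ λ c → c ∈ cs × sumℤ (toList xs) ≈ c)
  uncoverable {n} εs es cs {G} sep g u len s<p 2n<p covered =
    functional-nonzero (tops εs (descending n)) (rests [] εs (descending n)) (product (factors targets εs))
      distinct′ vanishes-below-top nonzero-at-top
      (≈-trans (≈-sym same) (functional-zero (boxes [] εs es) λ xs xs∈ → factors-vanish cs εs xs (covered xs xs∈)))
    where
    open Model εs s<p 2n<p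
    distinct : VAll.All Distinct (boxes [] εs es)
    distinct = distinct-boxes sep εs es (subst (All G) (sym (List.++-identityʳ _)) g) (subst Unique (sym (List.++-identityʳ _)) u)
    distinct′ : VAll.All Distinct (boxes [] εs (descending n))
    distinct′ = distinct-boxes (interval-separated n 2n<p) εs (descending n)
      (subst (All _) (sym (List.++-identityʳ _)) (descending-bounds n))
      (subst Unique (sym (List.++-identityʳ _)) (descending-unique n))
    len′ : length targets ≡ s
    len′ = trans (List.length-map target (upTo s)) (List.length-upTo s)
    degree : ∀ cs es → length cs ≡ s → length (factors cs εs) ℕ.+ n ℕ.≤ totalLength (boxes [] εs es)
    degree cs es len = ℕ.≤-reflexive (begin
      length (factors cs εs) ℕ.+ n                      ≡⟨ cong (ℕ._+ n) (length-factors cs εs) ⟩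
      length cs ℕ.+ length (pairForms εs) ℕ.+ n         ≡⟨ cong (λ l → l ℕ.+ length (pairForms εs) ℕ.+ n) len ⟩
      s ℕ.+ length (pairForms εs) ℕ.+ n                 ≡⟨ ℕ.+-identityʳ _ ⟨
      s ℕ.+ length (pairForms εs) ℕ.+ n ℕ.+ 0           ≡⟨ cong (s ℕ.+ length (pairForms εs) ℕ.+ n ℕ.+_) (ℕ.*-zeroʳ n) ⟨
      s ℕ.+ length (pairForms εs) ℕ.+ n ℕ.+ n ℕ.* 0     ≡⟨ totalLength-boxes [] εs es ⟨
      totalLength (boxes [] εs es)                      ∎)
      where open ≡-Reasoning
    same : functional (boxes [] εs es) (product (factors cs εs)) ≈
           functional (boxes [] εs (descending n)) (product (factors targets εs))
    same = functional-topDegree (factors cs εs) (factors targets εs) (boxes [] εs es) (boxes [] εs (descending n))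
      (forms-factors cs targets εs (trans len (sym len′))) (sameLengths-boxes [] [] εs es (descending n) refl)
      distinct distinct′ (degree cs es len) (degree targets (descending n) len′)

-- Filters, and subsets as lists of their elements.

module _ {a ℓ} {A : Set a} {P : Pred A ℓ} (P? : Decidable P) where

  sum-filter-¬ : ∀ (f : A → ℕ) xs →
    sum (List.map f (filter P? xs)) ℕ.+ sum (List.map f (filter (¬? ∘ P?) xs)) ≡ sum (List.map f xs)
  sum-filter-¬ f []       = refl
  sum-filter-¬ f (x ∷ xs) with P? x
  ... | yes _ = trans (ℕ.+-assoc (f x) _ _) (cong (f x ℕ.+_) (sum-filter-¬ f xs))
  ... | no  _ = begin
    m ℕ.+ (f x ℕ.+ n) ≡⟨ ℕ.+-assoc m (f x) n ⟨
    m ℕ.+ f x ℕ.+ n   ≡⟨ cong (ℕ._+ n) (ℕ.+-comm m (f x)) ⟩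
    f x ℕ.+ m ℕ.+ n   ≡⟨ ℕ.+-assoc (f x) m n ⟩
    f x ℕ.+ (m ℕ.+ n) ≡⟨ cong (f x ℕ.+_) (sum-filter-¬ f xs) ⟩
    f x ℕ.+ sum (List.map f xs) ∎
    where
    open ≡-Reasoning
    m = sum (List.map f (filter P? xs))
    n = sum (List.map f (filter (¬? ∘ P?) xs))

  length-filter-¬ : ∀ xs → length (filter P? xs) ℕ.+ length (filter (¬? ∘ P?) xs) ≡ length xs
  length-filter-¬ []       = refl
  length-filter-¬ (x ∷ xs) with P? x
  ... | yes _ = cong suc (length-filter-¬ xs)
  ... | no  _ = trans (ℕ.+-suc _ _) (cong suc (length-filter-¬ xs))

map-filter-∘ : ∀ {a b ℓ} {A : Set a} {B : Set b} {P : Pred B ℓ} (P? : Decidable P) (f : A → B) xs →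
  List.map f (filter (P? ∘ f) xs) ≡ filter P? (List.map f xs)
map-filter-∘ P? f []       = refl
map-filter-∘ P? f (x ∷ xs) with P? (f x)
... | yes _ = cong (f x ∷_) (map-filter-∘ P? f xs)
... | no  _ = map-filter-∘ P? f xs

filter-× : ∀ {a ℓ₁ ℓ₂ ℓ₃} {A : Set a} {P : Pred A ℓ₁} {Q : Pred A ℓ₂} {R : Pred A ℓ₃}
  (P? : Decidable P) (Q? : Decidable Q) (R? : Decidable R) →
  (∀ {x} → R x → P x × Q x) → (∀ {x} → P x → Q x → R x) →
  ∀ xs → filter R? xs ≡ filter Q? (filter P? xs)
filter-× P? Q? R? to from []       = refl
filter-× P? Q? R? to from (x ∷ xs) with P? x
... | yes px with Q? x | R? x
...   | yes qx | yes rx = cong (x ∷_) (filter-× P? Q? R? to from xs)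
...   | yes qx | no ¬rx = contradiction (from px qx) ¬rx
...   | no ¬qx | yes rx = contradiction (proj₂ (to rx)) ¬qx
...   | no ¬qx | no ¬rx = filter-× P? Q? R? to from xs
filter-× P? Q? R? to from (x ∷ xs) | no ¬px with R? x
...   | yes rx = contradiction (proj₁ (to rx)) ¬px
...   | no ¬rx = filter-× P? Q? R? to from xs

-- The same filter as in `natSum`, so `natSum S` unfolds to the sum of `map toℕ (elements S)`.
elements : ∀ {n} → Subset n → List (Fin n)
elements {n} S = filter (λ i → i ∈ₛ? S) (allFin n)

does-∈? : ∀ {n} (i : Fin n) (S : Subset n) → does (i ∈ₛ? S) ≡ Vec.lookup S i
does-∈? zero    (true  ∷ S) = refl
does-∈? zero    (false ∷ S) = refl
does-∈? (suc i) (_     ∷ S) = does-∈? i S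

length-filter-tabulate : ∀ {a ℓ m} {A : Set a} {P : Pred A ℓ} (P? : Decidable P) (f : Fin m → A) (S : Subset m) →
  (∀ i → does (P? (f i)) ≡ Vec.lookup S i) → length (filter P? (tabulate f)) ≡ ∣ S ∣
length-filter-tabulate P? f []      h = refl
length-filter-tabulate P? f (s ∷ S) h with does (P? (f zero)) | h zero
... | true  | refl = cong suc (length-filter-tabulate P? (f ∘ suc) S (h ∘ suc))
... | false | refl = length-filter-tabulate P? (f ∘ suc) S (h ∘ suc)

length-elements : ∀ {n} (S : Subset n) → length (elements S) ≡ ∣ S ∣
length-elements S = length-filter-tabulate (_∈ₛ? S) id S (λ i → does-∈? i S)

∈-elements⁺ : ∀ {n} {S : Subset n} {v} → v ∈ₛ S → v ∈ elements S
∈-elements⁺ {S = S} = ∈-filter⁺ (_∈ₛ? S) (∈-allFin _)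

∈-elements⁻ : ∀ {n} (S : Subset n) {v} → v ∈ elements S → v ∈ₛ S
∈-elements⁻ {n} S v∈ = proj₂ (∈-filter⁻ (_∈ₛ? S) {xs = allFin n} v∈)

elements-unique : ∀ {n} (S : Subset n) → Unique (elements S)
elements-unique {n} S = Unique.filter⁺ (_∈ₛ? S) (Unique.allFin⁺ n)

-- `SigmaLow` and `SigmaHigh` unfold to instances of this.
comprehension : ∀ {n ℓ} {P : Pred (Fin n) ℓ} → Decidable P → Subset n
comprehension P? = Vec.tabulate (λ v → does (P? v))

∈-comprehension⁺ : ∀ {n ℓ} {P : Pred (Fin n) ℓ} (P? : Decidable P) {v} → P v → v ∈ₛ comprehension P?
∈-comprehension⁺ P? {v} pv = Vec.lookup⇒[]= v _ (trans (Vec.lookup∘tabulate _ v) (dec-true (P? v) pv))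

∈-comprehension⁻ : ∀ {n ℓ} {P : Pred (Fin n) ℓ} (P? : Decidable P) {v} → v ∈ₛ comprehension P? → P v
∈-comprehension⁻ P? {v} v∈ with P? v | trans (sym (Vec.lookup∘tabulate (λ v → does (P? v)) v)) (Vec.[]=⇒lookup v∈)
... | yes pv | _ = pv

injection⇒∣∣≤ : ∀ {n} (S T : Subset n) (f : Fin n → Fin n) → (∀ {u v} → f u ≡ f v → u ≡ v) →
  (∀ {v} → v ∈ₛ S → f v ∈ₛ T) → ∣ S ∣ ℕ.≤ ∣ T ∣
injection⇒∣∣≤ S T f inj into = subst₂ ℕ._≤_
  (trans (List.length-map f (elements S)) (length-elements S)) (length-elements T)
  (unique-⊆⇒length≤ (Unique.map⁺ inj (elements-unique S)) λ w∈ →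
    let v , v∈ , w≡ = ∈-map⁻ f w∈ in subst (_∈ elements T) (sym w≡) (∈-elements⁺ (into (∈-elements⁻ S v∈))))

-- By `double-topSum` the numerators differ by the even number `2 T`, so the two floors differ by
-- exactly `T`.
triangular-difference : ∀ {d α} → α ℕ.≤ d →
  (d ℕ.* (d ℕ.+ 1)) ℕ./ 2 ℕ.∸ (α ℕ.* (α ℕ.+ 1)) ℕ./ 2 ≡ topSum d (d ℕ.∸ α)
triangular-difference {d} {α} α≤d = begin
  (d ℕ.* (d ℕ.+ 1)) ℕ./ 2 ℕ.∸ x ℕ./ 2   ≡⟨ cong (λ z → z ℕ./ 2 ℕ.∸ x ℕ./ 2) double ⟨
  (2 ℕ.* T ℕ.+ x) ℕ./ 2 ℕ.∸ x ℕ./ 2     ≡⟨ cong (ℕ._∸ x ℕ./ 2) (ℕ.+-distrib-/-∣ˡ x (ℕ.m∣m*n T)) ⟩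
  2 ℕ.* T ℕ./ 2 ℕ.+ x ℕ./ 2 ℕ.∸ x ℕ./ 2 ≡⟨ ℕ.m+n∸n≡m _ (x ℕ./ 2) ⟩
  2 ℕ.* T ℕ./ 2                         ≡⟨ cong (ℕ._/ 2) (ℕ.*-comm 2 T) ⟩
  T ℕ.* 2 ℕ./ 2                         ≡⟨ ℕ.m*n/n≡m T 2 ⟩
  T                                     ∎
  where
  open ≡-Reasoning
  x = α ℕ.* (α ℕ.+ 1)
  T = topSum d (d ℕ.∸ α)
  double : 2 ℕ.* T ℕ.+ x ≡ d ℕ.* (d ℕ.+ 1)
  double = subst (λ d′ → 2 ℕ.* topSum d′ (d ℕ.∸ α) ℕ.+ x ≡ d′ ℕ.* (d′ ℕ.+ 1)) (ℕ.m∸n+n≡m α≤d)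
    (double-topSum α (d ℕ.∸ α))

-- Residues in `Fin p`, and complements in A.

module Residues (p : ℕ) .{{_ : NonZero p}} where

  open Modular p

  toℕ-mod≈ : ∀ n → + toℕ (n mod p) ≈ + n
  toℕ-mod≈ n = ≈-trans (≡⇒≈ (cong +_ (Fin.toℕ-fromℕ< (ℕ.m%n<n n p))))
    (≈-sym (congruent (divides (+ (n ℕ./ p)) (begin
      + n - + (n ℕ.% p)
        ≡⟨ cong (λ z → + z - + (n ℕ.% p)) (ℕ.m≡m%n+[m/n]*n n p) ⟩
      + (n ℕ.% p) + + (n ℕ./ p ℕ.* p) - + (n ℕ.% p)
        ≡⟨ cancel (+ (n ℕ.% p)) (+ (n ℕ./ p ℕ.* p)) ⟩
      + (n ℕ./ p ℕ.* p)
        ≡⟨ ℤ.pos-* (n ℕ./ p) p ⟩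
      + (n ℕ./ p) * + p ∎))))
    where
    open ≡-Reasoning
    cancel : ∀ r q → r + q - r ≡ q
    cancel = solve-∀

  toℕ-≈-injective : ∀ {u v : Fin p} → + toℕ u ≈ + toℕ v → u ≡ v
  toℕ-≈-injective {u} {v} h = Fin.toℕ-injective (<p⇒≡ (Fin.toℕ<n u) (Fin.toℕ<n v) h)

  p∸≈ : ∀ (v : Fin p) → + (p ℕ.∸ toℕ v) ≈ - (+ toℕ v)
  p∸≈ v = congruent (divides 1ℤ (trans (identity (+ (p ℕ.∸ toℕ v)) (+ toℕ v))
    (trans (cong +_ (ℕ.m∸n+n≡m (Fin.toℕ≤n v))) (sym (ℤ.*-identityˡ (+ p))))))
    where
    identity : ∀ a b → a - - b ≡ a + b
    identity = solve-∀

  negF≈ : ∀ v → + toℕ (negF v) ≈ - (+ toℕ v)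
  negF≈ v = ≈-trans (toℕ-mod≈ (p ℕ.∸ toℕ v)) (p∸≈ v)

  module Complement (A : Subset p) where

    reflect : Fin p → Fin p
    reflect v = (natSum A ℕ.+ (p ℕ.∸ toℕ v)) mod p

    reflect≈ : ∀ v → + toℕ (reflect v) ≈ + natSum A - + toℕ v
    reflect≈ v = ≈-trans (toℕ-mod≈ _) (+-cong-≈ (≡⇒≈ {+ natSum A} refl) (p∸≈ v))

    -- Subtracting twice from the sum of `A` gives back the residue.
    reflect-injective : ∀ {u v} → reflect u ≡ reflect v → u ≡ v
    reflect-injective {u} {v} eq = toℕ-≈-injective (≈-trans (≈-sym (recover u))
      (≈-trans (≡⇒≈ (cong (λ w → + natSum A - + toℕ w) eq)) (recover v)))
      where
      identity : ∀ a b → a - (a - b) ≡ b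
      identity = solve-∀
      recover : ∀ v → + natSum A - + toℕ (reflect v) ≈ + toℕ v
      recover v = ≈-trans (+-cong-≈ (≡⇒≈ {+ natSum A} refl) (-‿cong-≈ (reflect≈ v))) (≡⇒≈ (identity (+ natSum A) (+ toℕ v)))

    module _ (B : Subset p) (B⊆A : B ⊆ₛ A) where

      minus? : Decidable (λ v → v ∈ₛ A × ¬ v ∈ₛ B)
      minus? v = (v ∈ₛ? A) ×-dec ¬? (v ∈ₛ? B)

      A∖B : Subset p
      A∖B = comprehension minus?

      A∖B⊆A : A∖B ⊆ₛ A
      A∖B⊆A v∈ = proj₁ (∈-comprehension⁻ minus? v∈)

      elements-B : elements B ≡ filter (_∈ₛ? B) (elements A)
      elements-B = filter-× (_∈ₛ? A) (_∈ₛ? B) (_∈ₛ? B) (λ v∈B → B⊆A v∈B , v∈B) (λ _ v∈B → v∈B) (allFin p)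

      elements-A∖B : elements A∖B ≡ filter (¬? ∘ (_∈ₛ? B)) (elements A)
      elements-A∖B = filter-× (_∈ₛ? A) (¬? ∘ (_∈ₛ? B)) (_∈ₛ? A∖B)
        (∈-comprehension⁻ minus?) (λ a b → ∈-comprehension⁺ minus? (a , b)) (allFin p)

      natSum-complement : natSum B ℕ.+ natSum A∖B ≡ natSum A
      natSum-complement = trans
        (cong₂ (λ xs ys → sum (List.map toℕ xs) ℕ.+ sum (List.map toℕ ys)) elements-B elements-A∖B)
        (sum-filter-¬ (_∈ₛ? B) toℕ (elements A))

      ∣∣-complement : ∣ B ∣ ℕ.+ ∣ A∖B ∣ ≡ ∣ A ∣
      ∣∣-complement = begin
        ∣ B ∣ ℕ.+ ∣ A∖B ∣                              ≡⟨ cong₂ ℕ._+_ (length-elements B) (length-elements A∖B) ⟨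
        length (elements B) ℕ.+ length (elements A∖B)  ≡⟨ cong₂ (λ xs ys → length xs ℕ.+ length ys) elements-B elements-A∖B ⟩
        _                                              ≡⟨ length-filter-¬ (_∈ₛ? B) (elements A) ⟩
        length (elements A)                            ≡⟨ length-elements A ⟩
        ∣ A ∣                                          ∎
        where open ≡-Reasoning

      sumF-complement : sumF A∖B ≡ reflect (sumF B)
      sumF-complement = toℕ-≈-injective (≈-trans (toℕ-mod≈ (natSum A∖B)) (≈-sym (≈-trans (reflect≈ (sumF B))
        (≈-trans (+-cong-≈ (≡⇒≈ {+ natSum A} refl) (-‿cong-≈ (toℕ-mod≈ (natSum B))))
          (≡⇒≈ (trans (cong (λ z → + z - + natSum B) (sym natSum-complement)) (identity (+ natSum B) (+ natSum A∖B))))))))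
        where
        identity : ∀ b c → b + c - b ≡ c
        identity = solve-∀

    -- Complements in `A` turn at least `α` summands into at most `∣ A ∣ ∸ α`, and reflect the sum.
    low⇒high : ∀ {α v} → InSigmaLow A α v → InSigmaHigh A α (reflect v)
    low⇒high {α} (B , B⊆A , α≤B , refl) = A∖B B B⊆A , A∖B⊆A B B⊆A ,
      subst (ℕ._≤ ∣ A ∣ ℕ.∸ α) (trans (cong (ℕ._∸ ∣ B ∣) (sym (∣∣-complement B B⊆A))) (ℕ.m+n∸m≡n ∣ B ∣ _))
        (ℕ.∸-monoʳ-≤ ∣ A ∣ α≤B) ,
      sumF-complement B B⊆A

    high⇒low : ∀ {α v} → α ℕ.≤ ∣ A ∣ → InSigmaHigh A α v → InSigmaLow A α (reflect v)
    high⇒low {α} α≤A (B , B⊆A , B≤ , refl) = A∖B B B⊆A , A∖B⊆A B B⊆A ,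
      -- Here `α ≤ ∣ A ∣` undoes the truncated subtraction.
      subst₂ ℕ._≤_ (ℕ.m∸[m∸n]≡n α≤A) (trans (cong (ℕ._∸ ∣ B ∣) (sym (∣∣-complement B B⊆A))) (ℕ.m+n∸m≡n ∣ B ∣ _))
        (ℕ.∸-monoʳ-≤ ∣ A ∣ B≤) ,
      sumF-complement B B⊆A

    ∣SigmaLow∣≡∣SigmaHigh∣ : ∀ {α} → α ℕ.≤ ∣ A ∣ → ∣ SigmaLow A α ∣ ≡ ∣ SigmaHigh A α ∣
    ∣SigmaLow∣≡∣SigmaHigh∣ {α} α≤A = ℕ.≤-antisym
      (injection⇒∣∣≤ (SigmaLow A α) (SigmaHigh A α) reflect reflect-injective
        (∈-comprehension⁺ (inSigmaHigh? A α) ∘ low⇒high ∘ ∈-comprehension⁻ (inSigmaLow? A α)))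
      (injection⇒∣∣≤ (SigmaHigh A α) (SigmaLow A α) reflect reflect-injective
        (∈-comprehension⁺ (inSigmaLow? A α) ∘ high⇒low α≤A ∘ ∈-comprehension⁻ (inSigmaHigh? A α)))

-- The lower bound for sums of at most |A| - α elements.

module LowerBound (p : ℕ) .{{_ : NonZero p}} (p-prime : Prime p) (A : Subset p) (A∩-A=∅ : Disjoint-neg A) where

  open Key p p-prime
  open Residues p

  InA : ℕ → Set
  InA a = ∃ λ v → v ∈ₛ A × a ≡ toℕ v

  -- The hypothesis on `A` and `-A` enters here: if `a + b` is 0 modulo `p`, then `b` is the residue
  -- of `- a`.
  separated : Separated InA
  separated = record
    { difference≉0 = λ { (u , _ , refl) (v , _ , refl) a≢b a-b≈0 →
        a≢b (cong toℕ (toℕ-≈-injective {u} {v} (≈-difference⇒≈ a-b≈0))) }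
    ; sum≉0 = λ { (u , u∈ , refl) (v , v∈ , refl) a+b≈0 → A∩-A=∅ u u∈
        (subst (_∈ₛ A) (toℕ-≈-injective (≈-trans (sum⇒neg (+ toℕ u) (+ toℕ v) a+b≈0) (≈-sym (negF≈ u)))) v∈) }
    }
    where
    identity : ∀ a b → b - - a ≡ a + b - 0ℤ
    identity = solve-∀
    sum⇒neg : ∀ a b → a + b ≈ 0ℤ → b ≈ - a
    sum⇒neg a b (congruent h) = congruent (subst ((+ p) ∣ℤ_) (sym (identity a b)) h)

  values : List ℕ
  values = List.map toℕ (elements A)

  values-InA : All InA values
  values-InA = All.map⁺ (All.tabulate λ {v} v∈ → v , ∈-elements⁻ A v∈ , refl)

  values-positive : All (0 ℕ.<_) values
  values-positive = All.map (λ g → ℕ.n≢0⇒n>0 λ { refl → Separated.sum≉0 separated g g (≡⇒≈ refl) }) values-InA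

  values-unique : Unique values
  values-unique = Unique.map⁺ Fin.toℕ-injective (elements-unique A)

  length-values : length values ≡ ∣ A ∣
  length-values = trans (List.length-map toℕ (elements A)) (length-elements A)

  -- The residue 0, the set `A` and its negative are pairwise disjoint in `Fin p`, which gives
  -- `1 + 2 ∣ A ∣ ≤ p`.
  2∣A∣<p : 2 ℕ.* length values ℕ.< p
  2∣A∣<p = subst₂ ℕ._≤_ (cong suc length-±) (List.length-tabulate id)
    (unique-⊆⇒length≤ {xs = 0F ∷ elements A ++ List.map negF (elements A)} (zero∉ ∷ unique) (λ _ → ∈-allFin _))
    where
    0F : Fin p
    0F = 0 mod p
    0F≈ : + toℕ 0F ≈ 0ℤ
    0F≈ = toℕ-mod≈ 0
    length-± : length (elements A ++ List.map negF (elements A)) ≡ 2 ℕ.* length values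
    length-± = trans (List.length-++ (elements A)) (cong₂ ℕ._+_ (sym (List.length-map toℕ (elements A)))
      (trans (List.length-map negF (elements A)) (trans (sym (List.length-map toℕ (elements A))) (sym (ℕ.+-identityʳ _)))))
    nonzero : ∀ {v} → v ∈ elements A → ¬ + toℕ v ≈ 0ℤ
    nonzero {v} v∈ v≈0 = Separated.sum≉0 separated (v , ∈-elements⁻ A v∈ , refl) (v , ∈-elements⁻ A v∈ , refl) (+-cong-≈ v≈0 v≈0)
    cancel-neg : ∀ {a b} → - a ≈ - b → a ≈ b
    cancel-neg {a} {b} h = ≈-trans (≡⇒≈ (sym (ℤ.neg-involutive a))) (≈-trans (-‿cong-≈ h) (≡⇒≈ (ℤ.neg-involutive b)))
    zero∉ : All (0F ≢_) (elements A ++ List.map negF (elements A))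
    zero∉ = All.++⁺ (All.tabulate λ { v∈ refl → nonzero v∈ 0F≈ })
      (All.map⁺ (All.tabulate λ {v} v∈ eq → nonzero v∈ (cancel-neg
        (≈-trans (≈-sym (negF≈ v)) (≈-trans (≡⇒≈ (cong (+_ ∘ toℕ) (sym eq))) 0F≈)))))
    negF-injective : ∀ {u v} → negF u ≡ negF v → u ≡ v
    negF-injective {u} {v} eq = toℕ-≈-injective (cancel-neg
      (≈-trans (≈-sym (negF≈ u)) (≈-trans (≡⇒≈ (cong (+_ ∘ toℕ) eq)) (negF≈ v))))
    unique : Unique (elements A ++ List.map negF (elements A))
    unique = Unique.++⁺ (elements-unique A) (Unique.map⁺ negF-injective (elements-unique A))
      λ (w∈ , w∈neg) → let v , v∈ , w≡ = ∈-map⁻ negF w∈neg in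
        A∩-A=∅ v (∈-elements⁻ A v∈) (subst (_∈ₛ A) w≡ (∈-elements⁻ A w∈))

  module _ (zs : List ℤ) where

    selected? : Decidable (λ v → v ∈ₛ A × + toℕ v ∈ zs)
    selected? v = (v ∈ₛ? A) ×-dec (+ toℕ v ∈? zs)

    -- The subset of `A` that carries the plus signs at the point `zs`.
    selected : Subset p
    selected = comprehension selected?

    values-selected : List.map toℕ (elements selected) ≡ positives zs values
    values-selected = trans
      (cong (List.map toℕ) (filter-× (_∈ₛ? A) (λ v → + toℕ v ∈? zs) (_∈ₛ? selected)
        (∈-comprehension⁻ selected?) (λ a b → ∈-comprehension⁺ selected? (a , b)) (allFin p)))
      (map-filter-∘ (λ e → + e ∈? zs) toℕ (elements A))

    ∣selected∣ : ∣ selected ∣ ≡ length (positives zs values)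
    ∣selected∣ = trans (sym (length-elements selected))
      (trans (sym (List.length-map toℕ (elements selected))) (cong length values-selected))

  -- If the set were too small, marks of weight equal to its size `q` would exist, and its `q`
  -- elements `v`, turned into `2 v - natSum A`, would catch all signed sums.
  sigmaHigh-bound : ∀ α → p ⊓ (topSum ∣ A ∣ (∣ A ∣ ℕ.∸ α) ℕ.+ 1) ℕ.≤ ∣ SigmaHigh A α ∣
  sigmaHigh-bound α = ℕ.≮⇒≥ λ small → let q<p = ℕ.<-≤-trans small (ℕ.m⊓n≤m p _)
                                          -- The `+ 1` in the bound makes `q` at most the largest
                                          -- weight available to `select`.
                                          q≤M = ℕ.m<1+n⇒m≤n (subst (q ℕ.<_) (ℕ.+-comm _ 1) (ℕ.<-≤-trans small (ℕ.m⊓n≤n p _)))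
                                          εs , w≡q , t≤h = select d (∣ A ∣ ℕ.∸ α) q
                                            (subst (λ d → q ℕ.≤ topSum d (∣ A ∣ ℕ.∸ α)) (sym length-values) q≤M)
    in uncoverable εs es cs separated
         (subst (All InA) (sym toList-es) values-InA) (subst Unique (sym toList-es) values-unique)
         (trans length-cs (sym w≡q)) (subst (ℕ._< p) (sym w≡q) q<p) 2∣A∣<p
         (covered εs t≤h)
    where
    q d : ℕ
    q = ∣ SigmaHigh A α ∣
    d = length values
    es : Vec ℕ d
    es = fromList values
    toList-es : toList es ≡ values
    toList-es = Vec.toList∘fromList values
    target : Fin p → ℤ
    target v = + 2 * + toℕ v - + natSum A
    cs : List ℤ
    cs = List.map target (elements (SigmaHigh A α))
    length-cs : length cs ≡ q
    length-cs = trans (List.length-map target (elements (SigmaHigh A α))) (length-elements (SigmaHigh A α))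
    covered : ∀ (εs : Vec Bool d) → trues εs ℕ.≤ ∣ A ∣ ℕ.∸ α → ∀ xs → Inside xs (boxes [] εs es) →
      NonDegenerate εs xs → ∃ λ c → c ∈ cs × sumℤ (toList xs) ≈ c
    -- The summands with a plus sign form a subset of at most `trues εs` elements, so its sum lies
    -- in `SigmaHigh A α`.
    covered εs t≤h xs xs∈ nd = target (sumF B) ,
      ∈-map⁺ target (∈-elements⁺ (∈-comprehension⁺ (inSigmaHigh? A α)
        (B , (λ v∈ → proj₁ (∈-comprehension⁻ (selected? zs) v∈)) , ∣B∣≤ , refl))) ,
      ≈-trans (≡⇒≈ Σ≡) (+-cong-≈ (*-cong-≈ (≡⇒≈ {+ 2} refl) (≈-sym (toℕ-mod≈ (natSum B)))) (≡⇒≈ { - (+ natSum A)} refl))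
      where
      zs : List ℤ
      zs = toList xs
      B : Subset p
      B = selected zs
      ∣B∣≤ : ∣ B ∣ ℕ.≤ ∣ A ∣ ℕ.∸ α
      ∣B∣≤ = ℕ.≤-trans (ℕ.≤-reflexive (∣selected∣ zs))
        (ℕ.≤-trans (length-positives-≤ εs es xs∈ values-unique values-positive) t≤h)
      Σ≡ : sumℤ zs ≡ + 2 * + natSum B - + natSum A
      Σ≡ = begin
        sumℤ zs
          ≡⟨ nonDegenerate-sum (subst Unique (sym toList-es) values-unique) (subst (All (0 ℕ.<_)) (sym toList-es) values-positive) xs∈ nd ⟩
        + 2 * + sum (positives zs (toList es)) - + sum (toList es)
          ≡⟨ cong (λ l → + 2 * + sum (positives zs l) - + sum l) toList-es ⟩
        + 2 * + sum (positives zs values) - + sum values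
          ≡⟨ cong (λ l → + 2 * + sum l - + sum values) (values-selected zs) ⟨
        + 2 * + natSum B - + natSum A ∎
        where open ≡-Reasoning

theorem4 : (p : ℕ) .{{_ : NonZero p}} → Prime p →
    (A : Subset p) → Disjoint-neg A →
    (α : ℕ) → α ℕ.≤ ∣ A ∣ →
    (∣ SigmaLow A α ∣ ≡ ∣ SigmaHigh A α ∣)
    × (p ⊓ ((∣ A ∣ ℕ.* (∣ A ∣ ℕ.+ 1)) ℕ./ 2 ℕ.∸ (α ℕ.* (α ℕ.+ 1)) ℕ./ 2 ℕ.+ 1) ℕ.≤ ∣ SigmaLow A α ∣)
theorem4 p p-prime A A∩-A=∅ α α≤A = low≡high ,
  subst₂ (λ M q → p ⊓ (M ℕ.+ 1) ℕ.≤ q) (sym (triangular-difference α≤A)) (sym low≡high)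
    (LowerBound.sigmaHigh-bound p p-prime A A∩-A=∅ α)
  where
  low≡high : ∣ SigmaLow A α ∣ ≡ ∣ SigmaHigh A α ∣
  low≡high = Residues.Complement.∣SigmaLow∣≡∣SigmaHigh∣ p A α≤A
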